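{- Let $1\le n<m$ and let $A=(a_{ij})_{m\times m}$ be a Cartier-Foata matrix, i.e. $a_{ik}a_{jl}=a_{jl}a_{ik}$ for all $i\neq j$ and all $k,l$. For $n<i,j\le m$ let $$c_{ij}=-\det{}^{ -1}(I-A_0)\cdot\det\begin{pmatrix} I-A_0 & -a_{*j}\\ -a_{i*} & -a_{ij}\end{pmatrix},\qquad C=(c_{ij})_{n+1\le i,j\le m}.$$ Then $\det{}^{ -1}(I-A_0)\cdot\det(I-A)=\det(I-C)$.
   Context: $\mathcal A$ is the $\mathbb C$-algebra of formal power series in non-commuting variables $a_{ij}$, $1\le i,j\le m$; identities are taken in the quotient of $\mathcal A$ by the closed two-sided ideal generated by the Cartier-Foata relations. $A_0=(a_{ij})_{1\le i,j\le n}$, $a_{i*}=(a_{i1},\dots,a_{in})$, $a_{*j}=(a_{1j},\dots,a_{nj})^T$. For a square matrix $B=(b_{rs})_{N\times N}$ with entries in $\mathcal A$, $\det B=\sum_{\sigma\in S_N}(-1)^{\operatorname{inv}\sigma}b_{\sigma(1)1}\cdots b_{\sigma(N)N}$ (column order of factors). $\det(I-A_0)$ has constant term $1$ and $\det^{ -1}(I-A_0)$ is its inverse. $\det(I-C)$ is computed by this same formula with the $c_{ij}$ as entries. -}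

module Defs where

open import Level using (_⊔_)
open import Algebra.Bundles using (CommutativeRing)
open import Data.Nat as ℕ using (ℕ; zero; suc; _+_)
open import Data.Fin as Fin using (Fin; _↑ˡ_; _↑ʳ_; splitAt)
open import Data.Fin.Properties using () renaming (_≟_ to _≟F_)
open import Data.List as List using (List; []; _∷_; _++_; length; allFin; upTo; foldr; map; concatMap)
open import Data.List.Properties using () renaming (≡-dec to List-≡-dec)
open import Data.Product using (Σ; _×_; _,_; proj₁; proj₂)
open import Data.Product.Properties using () renaming (≡-dec to ×-≡-dec)
open import Data.Sum using (inj₁; inj₂)
open import Data.Bool using (Bool; true; false; if_then_else_; not; _∧_; _∨_)
open import Data.Vec as Vec using (Vec; lookup)
open import Relation.Nullary using (¬_)
open import Relation.Nullary.Decidable using (⌊_⌋)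
open import Relation.Binary.PropositionalEquality using (_≡_; _≢_)

-- Everything is developed over an arbitrary commutative coefficient ring K
-- (the paper uses ℂ; the identity has integer coefficients).
module WithRing {c ℓ} (K : CommutativeRing c ℓ) where
  open CommutativeRing K renaming (Carrier to R; _+_ to _+R_; _*_ to _*R_)

  ΣR : List R → R
  ΣR = foldr _+R_ 0#

  -- letters a_ij, words, and formal power series (arbitrary coefficient
  -- functions on words) in the non-commuting variables a_ij, 1 ≤ i,j ≤ m
  Letter : ℕ → Set
  Letter m = Fin m × Fin m

  Word : ℕ → Set
  Word m = List (Letter m)

  Series : ℕ → Set c
  Series m = Word m → R

  module _ {m : ℕ} where
    _≟W_ : (u v : Word m) → Relation.Nullary.Dec (u ≡ v)
    _≟W_ = List-≡-dec (×-≡-dec _≟F_ _≟F_)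

    δ : Word m → Series m
    δ u w = if ⌊ u ≟W w ⌋ then 1# else 0#

    0S 1S : Series m
    0S _ = 0#
    1S = δ []

    _+S_ _-S_ _*S_ : Series m → Series m → Series m
    (f +S g) w = f w +R g w
    (f -S g) w = f w - g w

    -S_ : Series m → Series m
    (-S f) w = - f w

    scale : R → Series m → Series m
    scale r f w = r *R f w

    splits : Word m → List (Word m × Word m)
    splits [] = ([] , []) ∷ []
    splits (x ∷ w) = ([] , x ∷ w) ∷ map (λ p → (x ∷ proj₁ p , proj₂ p)) (splits w)

    (f *S g) w = ΣR (map (λ p → f (proj₁ p) *R g (proj₂ p)) (splits w))

    ΣS : List (Series m) → Series m
    ΣS = foldr _+S_ 0S

    ΠS : List (Series m) → Series m
    ΠS = foldr _*S_ 1S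

    powS : Series m → ℕ → Series m
    powS f zero = 1S
    powS f (suc k) = f *S powS f k

    -- inverse of a series f with constant term 1:  f⁻¹ = Σ_k (1 - f)^k
    -- (the k-th term vanishes on words of length < k)
    invS : Series m → Series m
    invS f w = ΣR (map (λ k → powS (1S -S f) k w) (upTo (suc (length w))))

    var : Fin m → Fin m → Series m
    var i j = δ ((i , j) ∷ [])

    idS : {N : ℕ} → Fin N → Fin N → Series m
    idS i j = if ⌊ i ≟F j ⌋ then 1S else 0S

    -- Leibniz determinant, column order of the factors:
    -- det B = Σ_σ (-1)^inv σ · b_{σ(1)1} ⋯ b_{σ(N)N}
    vecs : (N k : ℕ) → List (Vec (Fin N) k)
    vecs N zero = Vec.[] ∷ []
    vecs N (suc k) = concatMap (λ i → map (i Vec.∷_) (vecs N k)) (allFin N)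

    notIn : {N k : ℕ} → Fin N → Vec (Fin N) k → Bool
    notIn x Vec.[] = true
    notIn x (y Vec.∷ ys) = not ⌊ x ≟F y ⌋ ∧ notIn x ys

    distinct : {N k : ℕ} → Vec (Fin N) k → Bool
    distinct Vec.[] = true
    distinct (x Vec.∷ xs) = notIn x xs ∧ distinct xs

    perms : (N : ℕ) → List (Vec (Fin N) N)
    perms N = List.filterᵇ distinct (vecs N N)

    smaller : {N k : ℕ} → Fin N → Vec (Fin N) k → ℕ
    smaller x Vec.[] = 0
    smaller x (y Vec.∷ ys) = (if ⌊ y Fin.<? x ⌋ then 1 else 0) + smaller x ys

    inversions : {N k : ℕ} → Vec (Fin N) k → ℕ
    inversions Vec.[] = 0
    inversions (x Vec.∷ xs) = smaller x xs + inversions xs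

    sign : ℕ → R
    sign zero = 1#
    sign (suc k) = - sign k

    det : (N : ℕ) → (Fin N → Fin N → Series m) → Series m
    det N B = ΣS (map (λ σ → scale (sign (inversions σ))
                                 (ΠS (map (λ j → B (lookup σ j) j) (allFin N))))
                      (perms N))

    -- closed two-sided ideal generated by the Cartier–Foata relations
    -- a_ik a_jl - a_jl a_ik  (i ≠ j).  Since the relations are homogeneous,
    -- a series lies in the closure iff each homogeneous component lies in
    -- the (algebraic) ideal, i.e. is a finite combination  Σ c · u (xy - yx) v.
    record CFTerm : Set c where
      field
        coef  : R
        left  : Word m
        x y   : Letter m
        rows≢ : proj₁ x ≢ proj₁ y
        right : Word m

    termS : CFTerm → Series m
    termS t = scale coef (δ (left ++ x ∷ y ∷ right) -S δ (left ++ y ∷ x ∷ right))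
      where open CFTerm t

    InCFIdeal : Series m → Set (c ⊔ ℓ)
    InCFIdeal h = (d : ℕ) → Σ (List CFTerm) λ ts →
      (w : Word m) → length w ≡ d → h w ≈ ΣS (map termS ts) w

    _≈CF_ : Series m → Series m → Set (c ⊔ ℓ)
    f ≈CF g = InCFIdeal (f -S g)

  -- The data of Theorem 5.4, with m = n + k (so n < m ⟺ k ≥ 1).
  module Thm54 (n k : ℕ) where
    A : Fin (n + k) → Fin (n + k) → Series (n + k)
    A = var

    I-A : Fin (n + k) → Fin (n + k) → Series (n + k)
    I-A i j = idS i j -S A i j

    I-A₀ : Fin n → Fin n → Series (n + k)
    I-A₀ i j = idS i j -S A (i ↑ˡ k) (j ↑ˡ k)

    block : Fin k → Fin k → Fin (n + 1) → Fin (n + 1) → Series (n + k)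
    block i j r s with splitAt n r | splitAt n s
    ... | inj₁ r' | inj₁ s' = I-A₀ r' s'
    ... | inj₁ r' | inj₂ _  = -S A (r' ↑ˡ k) (n ↑ʳ j)
    ... | inj₂ _  | inj₁ s' = -S A (n ↑ʳ i) (s' ↑ˡ k)
    ... | inj₂ _  | inj₂ _  = -S A (n ↑ʳ i) (n ↑ʳ j)

    detInvA₀ : Series (n + k)
    detInvA₀ = invS (det n I-A₀)

    C : Fin k → Fin k → Series (n + k)
    C i j = -S (detInvA₀ *S det (n + 1) (block i j))

    I-C : Fin k → Fin k → Series (n + k)
    I-C i j = idS i j -S C i j

{-# OPTIONS --safe #-}
module Submission where

-- Columns c of a matrix act on functions of index lists by multiplication with
-- Σ_x c(x) ξ_x, the ξ_x anticommuting, and determinants are the coefficients of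
-- products of such operators.  When entries in different rows commute, the
-- operators of the columns anticommute.  Hence, with b_l the first n columns of
-- I - A, every later column can be changed by Σ_l b_l X_l without changing
-- b_1 ⋯ b_n (later columns), the coefficients X_l standing on the right and being
-- otherwise arbitrary.  Choosing X so that the top entries of the later columns
-- vanish gives det(I - A) = det(I - A₀) · det E with E the Schur complement.  The
-- same identity for the bordered blocks shows that I - C = E.

open import Defs
open import Algebra.Bundles using (CommutativeMonoid; CommutativeRing; Ring)
import Algebra.Properties.Ring
import Algebra.Properties.Semiring.Sum
open import Data.Bool using (Bool; true; false; if_then_else_; not; _∧_)
open import Data.Fin as Fin using (Fin; zero; suc; _↑ˡ_; _↑ʳ_; splitAt)
import Data.Fin.Properties as Finₚ
open import Data.List as List using (List; []; _∷_; _++_; _∷ʳ_; length; map; foldr; tabulate; lookup; concatMap; filterᵇ; allFin; upTo; initLast; _∷ʳ′_)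
open import Data.List.Membership.Propositional using (_∈_)
open import Data.List.Membership.Propositional.Properties using (∈-tabulate⁺; ∈-tabulate⁻; ∈-lookup; ∈-map⁺; ∈-++⁺ʳ)
import Data.List.Properties as Listₚ
open import Data.List.Relation.Unary.Any using (here; there)
open import Data.Nat as ℕ using (ℕ; zero; suc; _≤_; z≤n; s≤s) renaming (_+_ to _+ℕ_)
import Data.Nat.Properties as ℕₚ
open import Data.Product using (Σ; ∃; _×_; _,_; proj₁; proj₂)
open import Data.Product.Properties using () renaming (≡-dec to ×-≡-dec)
open import Data.Sum using (inj₁; inj₂)
open import Data.Vec as Vec using (Vec; []; _∷_; toList)
open import Function using (_∘_)
open import Level using (_⊔_) renaming (suc to lsuc)
open import Relation.Binary.PropositionalEquality as ≡ using (_≡_; _≢_; subst)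
open import Relation.Binary.Structures using (IsEquivalence)
open import Relation.Nullary using (Dec; yes; no; contradiction)
open import Relation.Nullary.Decidable using (⌊_⌋)

-- The obstacle is that an eliminated column has entries involving X, which need not commute with
-- anything, so after one replacement the new column no longer anticommutes with the b_l. A weaker
-- property survives: the operator standing to the left still annihilates every b_l. It is passed on
-- by turning the new column back into the original one, exchanging that one with b_l, and using the
-- annihilation already known. Hence elimination is stated for additive operators with this property
-- and not for determinants.
--
-- No inverse of I - A₀ is formed. Only the system (I - A₀) X = -a_{*j} enters, and it is solvable
-- among free series, before any quotient, because multiplication by a variable raises the degree.
-- Its solution depends on j but not on i, so one X serves I - A and all bordered blocks; their
-- Schur complements then agree, up to the identity entry that the blocks lack.

module Alternating {c ℓ} (𝓡 : Ring c ℓ) where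
  open Ring 𝓡 hiding (zero)
  open import Algebra.Properties.Ring 𝓡
  private
    module Sum = Algebra.Properties.Semiring.Sum semiring
  open import Algebra.Properties.CommutativeSemigroup (CommutativeMonoid.commutativeSemigroup +-commutativeMonoid) public
    using () renaming (interchange to +-interchange)
  open import Relation.Binary.Reasoning.Setoid setoid

  -- Finite sums in a noncommutative ring

  +-vanishˡ : ∀ {x y} → x ≈ 0# → x + y ≈ y
  +-vanishˡ h = trans (+-congʳ h) (+-identityˡ _)

  +-vanishʳ : ∀ {x y} → y ≈ 0# → x + y ≈ x
  +-vanishʳ h = trans (+-congˡ h) (+-identityʳ _)

  +-vanish : ∀ {x y} → x ≈ 0# → y ≈ 0# → x + y ≈ 0#
  +-vanish h h′ = trans (+-vanishˡ h) h′

  *-vanishˡ : ∀ {x y} → x ≈ 0# → x * y ≈ 0#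
  *-vanishˡ h = trans (*-congʳ h) (zeroˡ _)

  *-vanishʳ : ∀ {x y} → y ≈ 0# → x * y ≈ 0#
  *-vanishʳ h = trans (*-congˡ h) (zeroʳ _)

  -- Opaque, so that f can be inferred from ∑ f.
  opaque
    ∑ : ∀ {N} → (Fin N → Carrier) → Carrier
    ∑ = Sum.sum

    ∑-suc : ∀ {N} (f : Fin (suc N) → Carrier) → ∑ f ≈ f zero + ∑ (f ∘ suc)
    ∑-suc f = refl

    ∑-empty : (f : Fin 0 → Carrier) → ∑ f ≈ 0#
    ∑-empty f = refl

    ∑-cong : ∀ {N} {f g : Fin N → Carrier} → (∀ x → f x ≈ g x) → ∑ f ≈ ∑ g
    ∑-cong = Sum.sum-cong-≋

    ∑-+ : ∀ {N} (f g : Fin N → Carrier) → ∑ (λ x → f x + g x) ≈ ∑ f + ∑ g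
    ∑-+ = Sum.∑-distrib-+

    ∑-comm : ∀ {M N} (f : Fin M → Fin N → Carrier) → ∑ (λ x → ∑ λ y → f x y) ≈ ∑ (λ y → ∑ λ x → f x y)
    ∑-comm = Sum.∑-comm

    ∑-zero : ∀ {N} {f : Fin N → Carrier} → (∀ x → f x ≈ 0#) → ∑ f ≈ 0#
    ∑-zero {N} h = trans (∑-cong h) (Sum.sum-replicate-zero N)

    *-distribˡ-∑ : ∀ {N} a (f : Fin N → Carrier) → a * ∑ f ≈ ∑ (λ x → a * f x)
    *-distribˡ-∑ = Sum.*-distribˡ-sum

    *-distribʳ-∑ : ∀ {N} a (f : Fin N → Carrier) → ∑ f * a ≈ ∑ (λ x → f x * a)
    *-distribʳ-∑ = Sum.*-distribʳ-sum

    ∑-splitAt : ∀ n {k} (f : Fin (n +ℕ k) → Carrier) →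
                ∑ f ≈ ∑ (λ i → f (i ↑ˡ k)) + ∑ (λ j → f (n ↑ʳ j))
    ∑-splitAt zero    f = sym (+-identityˡ _)
    ∑-splitAt (suc n) f = trans (+-congˡ (∑-splitAt n (f ∘ suc))) (sym (+-assoc _ _ _))

    -- The first row and the first column cancel entry by entry, and the rest is a smaller case. The
    -- diagonal has its own hypothesis because 2 may be a zero divisor.
    ∑-antisym : ∀ {N} (g : Fin N → Fin N → Carrier) → (∀ x → g x x ≈ 0#) →
                (∀ x y → g x y + g y x ≈ 0#) → ∑ (λ x → ∑ (g x)) ≈ 0#
    ∑-antisym {zero}  g diag anti = refl
    ∑-antisym {suc N} g diag anti = begin
      (g zero zero + row) + ∑ (λ x → g (suc x) zero + ∑ (g (suc x) ∘ suc))
        ≈⟨ +-cong (+-vanishˡ (diag zero)) (∑-+ (λ x → g (suc x) zero) _) ⟩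
      row + (∑ (λ x → g (suc x) zero) + ∑ (λ x → ∑ (g (suc x) ∘ suc)))
        ≈⟨ sym (+-assoc row _ _) ⟩
      (row + ∑ (λ x → g (suc x) zero)) + ∑ (λ x → ∑ (g (suc x) ∘ suc))
        ≈⟨ +-vanish
             (trans (sym (∑-+ (g zero ∘ suc) _)) (∑-zero (λ x → anti zero (suc x))))
             (∑-antisym (λ x y → g (suc x) (suc y)) (diag ∘ suc) (λ x y → anti (suc x) (suc y))) ⟩
      0# ∎
      where
      row : Carrier
      row = ∑ (g zero ∘ suc)

  -- Contraction by columns and alternating forms

  Column : ℕ → Set c
  Column N = Fin N → Carrier

  Form : ℕ → Set c
  Form N = List (Fin N) → Carrier

  -- Multiplication by a column Σ_x c(x) ξ_x of anticommuting ξ_x, read on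
  -- coefficient functions; a product of columns is then a determinant.
  contract : ∀ {N} → Column N → Form N → Form N
  contract c ψ u = ∑ λ x → c x * ψ (u ∷ʳ x)

  contractAll : ∀ {N} → List (Column N) → Form N → Form N
  contractAll cs ψ = foldr contract ψ cs

  infix 4 _≋_
  _≋_ : ∀ {N} → Form N → Form N → Set ℓ
  ψ ≋ φ = ∀ u → ψ u ≈ φ u

  -- Lists of every length are covered, because partially contracted forms are evaluated on
  -- partially filled lists. Only neighbours are exchanged, which is stable under appending further
  -- indices.
  record Alt {N} (ψ : Form N) : Set ℓ where
    field
      repeat : ∀ p x q → ψ (p ++ x ∷ x ∷ q) ≈ 0#
      swap   : ∀ p x y q → ψ (p ++ x ∷ y ∷ q) + ψ (p ++ y ∷ x ∷ q) ≈ 0#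
  open Alt

  contract-cong : ∀ {N} (c : Column N) {ψ φ} → ψ ≋ φ → contract c ψ ≋ contract c φ
  contract-cong c h u = ∑-cong λ x → *-congˡ (h _)

  contractAll-cong : ∀ {N} (cs : List (Column N)) {ψ φ} → ψ ≋ φ → contractAll cs ψ ≋ contractAll cs φ
  contractAll-cong []       h = h
  contractAll-cong (c ∷ cs) h = contract-cong c (contractAll-cong cs h)

  -- Each column appends exactly one index, so only extensions of `u` by `length cs` entries are
  -- ever read. This length is what the pigeonhole argument needs later.
  contractAll-cong-length : ∀ {N} (cs : List (Column N)) {ψ φ} u →
    (∀ w → length w ≡ length cs → ψ (u ++ w) ≈ φ (u ++ w)) → contractAll cs ψ u ≈ contractAll cs φ u
  contractAll-cong-length [] {ψ} {φ} u h =
    subst (λ v → ψ v ≈ φ v) (Listₚ.++-identityʳ u) (h [] ≡.refl)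
  contractAll-cong-length (c ∷ cs) {ψ} {φ} u h = ∑-cong λ x → *-congˡ
    (contractAll-cong-length cs (u ∷ʳ x) λ w eq →
      subst (λ v → ψ v ≈ φ v) (≡.sym (Listₚ.++-assoc u (x ∷ []) w)) (h (x ∷ w) (≡.cong suc eq)))

  contract-zero : ∀ {N} (c : Column N) {ψ} → (∀ u → ψ u ≈ 0#) → ∀ u → contract c ψ u ≈ 0#
  contract-zero c h u = ∑-zero λ x → *-vanishʳ (h _)

  contractAll-zero : ∀ {N} (cs : List (Column N)) {ψ} → (∀ u → ψ u ≈ 0#) → ∀ u → contractAll cs ψ u ≈ 0#
  contractAll-zero []       h = h
  contractAll-zero (c ∷ cs) h = contract-zero c (contractAll-zero cs h)

  contract-+ : ∀ {N} (c : Column N) ψ φ → contract c (λ u → ψ u + φ u) ≋ λ u → contract c ψ u + contract c φ u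
  contract-+ c ψ φ u = trans (∑-cong λ x → distribˡ _ _ _) (∑-+ (λ x → c x * ψ (u ∷ʳ x)) _)

  contractAll-+ : ∀ {N} (cs : List (Column N)) ψ φ →
    contractAll cs (λ u → ψ u + φ u) ≋ λ u → contractAll cs ψ u + contractAll cs φ u
  contractAll-+ []       ψ φ u = refl
  contractAll-+ (c ∷ cs) ψ φ u =
    trans (contract-cong c (contractAll-+ cs ψ φ) u) (contract-+ c (contractAll cs ψ) (contractAll cs φ) u)

  -- Entries of the columns multiply from the left, so a factor on the right of the form is never
  -- crossed.
  contractAll-*ʳ : ∀ {N} (cs : List (Column N)) ψ r →
    contractAll cs (λ u → ψ u * r) ≋ λ u → contractAll cs ψ u * r
  contractAll-*ʳ []       ψ r u = refl
  contractAll-*ʳ (c ∷ cs) ψ r u = begin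
    ∑ (λ x → c x * contractAll cs (λ v → ψ v * r) (u ∷ʳ x))
      ≈⟨ ∑-cong (λ x → trans (*-congˡ (contractAll-*ʳ cs ψ r _)) (sym (*-assoc _ _ _))) ⟩
    ∑ (λ x → c x * contractAll cs ψ (u ∷ʳ x) * r)
      ≈⟨ sym (*-distribʳ-∑ r (λ x → c x * contractAll cs ψ (u ∷ʳ x))) ⟩
    contractAll (c ∷ cs) ψ u * r ∎

  contractAll-++ : ∀ {N} (cs ds : List (Column N)) ψ →
    contractAll (cs ++ ds) ψ ≡ contractAll cs (contractAll ds ψ)
  contractAll-++ cs ds ψ = Listₚ.foldr-++ contract ψ cs ds

  contract-Alt : ∀ {N} (c : Column N) {ψ} → Alt ψ → Alt (contract c ψ)
  contract-Alt c {ψ} alt .repeat p x q = ∑-zero λ z → *-vanishʳ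
    (trans (reflexive (≡.cong ψ (Listₚ.++-assoc p (x ∷ x ∷ q) _))) (repeat alt p x (q ∷ʳ z)))
  contract-Alt c {ψ} alt .swap p x y q =
    trans (sym (∑-+ (λ z → c z * ψ ((p ++ x ∷ y ∷ q) ∷ʳ z)) _))
      (∑-zero λ z → trans (sym (distribˡ _ _ _)) (*-vanishʳ
        (trans (reflexive (≡.cong₂ (λ v w → ψ v + ψ w)
                  (Listₚ.++-assoc p (x ∷ y ∷ q) _) (Listₚ.++-assoc p (y ∷ x ∷ q) _)))
               (swap alt p x y (q ∷ʳ z)))))

  contractAll-Alt : ∀ {N} (cs : List (Column N)) {ψ} → Alt ψ → Alt (contractAll cs ψ)
  contractAll-Alt []       alt = alt
  contractAll-Alt (c ∷ cs) alt = contract-Alt c (contractAll-Alt cs alt)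

  *-Alt : ∀ {N} r {ψ : Form N} → Alt ψ → Alt (λ u → r * ψ u)
  *-Alt r alt .repeat p x q = *-vanishʳ (repeat alt p x q)
  *-Alt r alt .swap p x y q = trans (sym (distribˡ _ _ _)) (*-vanishʳ (swap alt p x y q))

  -- Entries in the same row may fail to commute: in a product of two contractions their terms carry
  -- a repeated index and die on an alternating form.
  CommuteOffDiagonal : ∀ {N} → Column N → Column N → Set ℓ
  CommuteOffDiagonal a b = ∀ x y → x ≢ y → a x * b y ≈ b y * a x

  contract-expand₂ : ∀ {N} (a b : Column N) ψ u →
    contract a (contract b ψ) u ≈ ∑ λ x → ∑ λ y → a x * b y * ψ (u ++ x ∷ y ∷ [])
  contract-expand₂ a b ψ u = ∑-cong λ x →
    trans (*-distribˡ-∑ (a x) (λ y → b y * ψ ((u ∷ʳ x) ∷ʳ y)))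
      (∑-cong λ y → trans (sym (*-assoc _ _ _))
        (*-congˡ (reflexive (≡.cong ψ (Listₚ.++-assoc u (x ∷ []) (y ∷ []))))))

  contract-anticomm : ∀ {N} {a b : Column N} {ψ} → CommuteOffDiagonal a b → Alt ψ → ∀ u →
    contract a (contract b ψ) u + contract b (contract a ψ) u ≈ 0#
  contract-anticomm {a = a} {b} {ψ} comm alt u = begin
    contract a (contract b ψ) u + contract b (contract a ψ) u
      ≈⟨ +-cong (contract-expand₂ a b ψ u) (contract-expand₂ b a ψ u) ⟩
    ∑ (λ x → ∑ λ y → F x y) + ∑ (λ x → ∑ λ y → G y x)
      -- Swapping the summations in the second sum pairs the terms built from the same entries `a x`
      -- and `b y`.
      ≈⟨ +-congˡ (∑-comm (λ x y → G y x)) ⟩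
    ∑ (λ x → ∑ λ y → F x y) + ∑ (λ x → ∑ λ y → G x y)
      ≈⟨ sym (∑-+ (λ x → ∑ (F x)) _) ⟩
    ∑ (λ x → ∑ (F x) + ∑ (G x))
      ≈⟨ ∑-cong (λ x → sym (∑-+ (F x) (G x))) ⟩
    ∑ (λ x → ∑ λ y → F x y + G x y)
      ≈⟨ ∑-zero (λ x → ∑-zero (cancel x)) ⟩
    0# ∎
    where
    F G : Fin _ → Fin _ → Carrier
    F x y = a x * b y * ψ (u ++ x ∷ y ∷ [])
    G x y = b y * a x * ψ (u ++ y ∷ x ∷ [])
    cancel : ∀ x y → F x y + G x y ≈ 0#
    cancel x y with x Finₚ.≟ y
    ... | yes ≡.refl = +-vanish (*-vanishʳ (repeat alt u x [])) (*-vanishʳ (repeat alt u x []))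
    ... | no x≢y = trans (+-congˡ (*-congʳ (sym (comm x y x≢y))))
                     (trans (sym (distribˡ _ _ _)) (*-vanishʳ (swap alt u x y [])))

  -- Anticommutation of `a` with itself would only give twice this value, so the double sum is
  -- cancelled directly by `∑-antisym`.
  contract-square : ∀ {N} {a : Column N} {ψ} → CommuteOffDiagonal a a → Alt ψ → ∀ u →
    contract a (contract a ψ) u ≈ 0#
  contract-square {a = a} {ψ} comm alt u = trans (contract-expand₂ a a ψ u)
    (∑-antisym F (λ x → *-vanishʳ (repeat alt u x [])) anti)
    where
    F : Fin _ → Fin _ → Carrier
    F x y = a x * a y * ψ (u ++ x ∷ y ∷ [])
    anti : ∀ x y → F x y + F y x ≈ 0#
    anti x y with x Finₚ.≟ y
    ... | yes ≡.refl = +-vanish (*-vanishʳ (repeat alt u x [])) (*-vanishʳ (repeat alt u x []))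
    ... | no x≢y = trans (+-congˡ (*-congʳ (sym (comm x y x≢y))))
                     (trans (sym (distribˡ _ _ _)) (*-vanishʳ (swap alt u x y [])))

  -- The left copy of `a` is moved rightwards past one column at a time until it meets the other
  -- copy. Signs need no bookkeeping, since the term with `a` already moved is zero by induction.
  contract-sandwich : ∀ {N} {a : Column N} cs → CommuteOffDiagonal a a →
    (∀ {c} → c ∈ cs → CommuteOffDiagonal a c) → ∀ {ψ} → Alt ψ → ∀ u →
    contract a (contractAll cs (contract a ψ)) u ≈ 0#
  contract-sandwich []       comm comms alt u = contract-square comm alt u
  contract-sandwich {a = a} (c ∷ cs) comm comms {ψ} alt u =
    trans (sym (+-vanishʳ (contract-zero c (contract-sandwich cs comm (comms ∘ there) alt) u)))
      (contract-anticomm (comms (here ≡.refl)) (contractAll-Alt cs (contract-Alt a alt)) u)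

  -- The copy of `a` inside `cs` and the one to the right of `cs` enclose a sandwich; the columns
  -- before it only act on zero. With the b_l for `cs`, this is the annihilation that elimination
  -- starts from.
  contractAll-member : ∀ {N} {a : Column N} cs → a ∈ cs →
    (∀ {c} → c ∈ cs → CommuteOffDiagonal a c) → ∀ {ψ} → Alt ψ → ∀ u →
    contractAll cs (contract a ψ) u ≈ 0#
  contractAll-member (a ∷ cs) (here ≡.refl) comms =
    contract-sandwich cs (comms (here ≡.refl)) (comms ∘ there)
  contractAll-member (c ∷ cs) (there m) comms alt =
    contract-zero c (contractAll-member cs m (comms ∘ there) alt)

  -- Column elimination under additive operators

  record Linear {N} (F : Form N → Form N) : Set (c ⊔ ℓ) where
    field
      cong : ∀ {ψ φ} → ψ ≋ φ → F ψ ≋ F φ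
      add  : ∀ ψ φ → F (λ u → ψ u + φ u) ≋ λ u → F ψ u + F φ u
      zeros : ∀ {ψ} → (∀ u → ψ u ≈ 0#) → ∀ u → F ψ u ≈ 0#

  contractAll-Linear : ∀ {N} (cs : List (Column N)) → Linear (contractAll cs)
  contractAll-Linear cs = record
    { cong = contractAll-cong cs ; add = contractAll-+ cs ; zeros = contractAll-zero cs }

  Linear-∘-contract : ∀ {N} {F : Form N → Form N} c → Linear F → Linear (F ∘ contract c)
  Linear-∘-contract c lin = record
    { cong  = λ h → L.cong (contract-cong c h)
    ; add   = λ ψ φ u → trans (L.cong (contract-+ c ψ φ) u) (L.add _ _ u)
    ; zeros = λ h → L.zeros (contract-zero c h) }
    where module L = Linear lin

  Linear-∑ : ∀ {N M} {F : Form N → Form N} → Linear F → (ψ : Fin M → Form N) →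
    F (λ u → ∑ λ l → ψ l u) ≋ λ u → ∑ λ l → F (ψ l) u
  Linear-∑ {M = zero}  lin ψ u = trans (Linear.zeros lin (λ _ → ∑-empty _) u) (sym (∑-empty _))
  Linear-∑ {M = suc M} {F} lin ψ u = begin
    F (λ v → ∑ λ l → ψ l v) u                     ≈⟨ L.cong (λ v → ∑-suc (λ l → ψ l v)) u ⟩
    F (λ v → ψ zero v + ∑ λ l → ψ (suc l) v) u    ≈⟨ L.add _ _ u ⟩
    F (ψ zero) u + F (λ v → ∑ λ l → ψ (suc l) v) u ≈⟨ +-congˡ (Linear-∑ lin (ψ ∘ suc) u) ⟩
    F (ψ zero) u + ∑ (λ l → F (ψ (suc l)) u)      ≈⟨ sym (∑-suc (λ l → F (ψ l) u)) ⟩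
    ∑ (λ l → F (ψ l) u)                           ∎
    where module L = Linear lin

  -- Subtracting right multiples of the columns b_l from c changes nothing
  -- under an F that kills the b_l: the coefficients X_l can be absorbed into
  -- the alternating form standing to the right of the column.
  module Elimination {N M} (b : Fin M → Column N) where

    -- Quantified over all alternating forms, so that the coefficients X_l and the columns further
    -- right can both be part of `ψ`.
    Kills : (Form N → Form N) → Set (c ⊔ ℓ)
    Kills F = ∀ l {ψ} → Alt ψ → ∀ u → F (contract (b l) ψ) u ≈ 0#

    _≈_mod_ : Column N → Column N → (Fin M → Carrier) → Set ℓ
    c ≈ η mod X = ∀ x → c x ≈ η x + ∑ λ l → b l x * X l

    eliminate : ∀ {F} → Linear F → Kills F → ∀ {c η X} → c ≈ η mod X →
      ∀ {ψ} → Alt ψ → ∀ u → F (contract c ψ) u ≈ F (contract η ψ) u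
    eliminate {F} lin kills {c} {η} {X} eq {ψ} alt u = begin
      F (contract c ψ) u
        ≈⟨ L.cong split u ⟩
      F (λ v → contract η ψ v + ∑ λ l → contract (b l) (λ w → X l * ψ w) v) u
        ≈⟨ L.add _ _ u ⟩
      F (contract η ψ) u + F (λ v → ∑ λ l → contract (b l) (λ w → X l * ψ w) v) u
        ≈⟨ +-vanishʳ (trans (Linear-∑ lin (λ l → contract (b l) (λ w → X l * ψ w)) u)
             (∑-zero λ l → kills l (*-Alt (X l) alt) u)) ⟩
      F (contract η ψ) u ∎
      where
      module L = Linear lin
      split : contract c ψ ≋ λ v → contract η ψ v + ∑ λ l → contract (b l) (λ w → X l * ψ w) v
      split v = begin
        ∑ (λ x → c x * ψ (v ∷ʳ x))
          ≈⟨ ∑-cong (λ x → trans (*-congʳ (eq x)) (distribʳ _ _ _)) ⟩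
        ∑ (λ x → η x * ψ (v ∷ʳ x) + ∑ (λ l → b l x * X l) * ψ (v ∷ʳ x))
          ≈⟨ ∑-+ (λ x → η x * ψ (v ∷ʳ x)) _ ⟩
        contract η ψ v + ∑ (λ x → ∑ (λ l → b l x * X l) * ψ (v ∷ʳ x))
          ≈⟨ +-congˡ (∑-cong λ x → trans (*-distribʳ-∑ _ (λ l → b l x * X l))
               (∑-cong λ l → *-assoc _ _ _)) ⟩
        contract η ψ v + ∑ (λ x → ∑ λ l → b l x * (X l * ψ (v ∷ʳ x)))
          ≈⟨ +-congˡ (∑-comm (λ x l → b l x * (X l * ψ (v ∷ʳ x)))) ⟩
        contract η ψ v + ∑ (λ l → contract (b l) (λ w → X l * ψ w) v) ∎

    -- The column `η` cannot be exchanged with `b l`, but `c` can. Under `F` the two agree, so `η`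
    -- is traded for `c`, then `c` is moved past `b l`, which `F` kills.
    Kills-∘-contract : ∀ {F} → Linear F → Kills F → ∀ {c η X} → c ≈ η mod X →
      (∀ l → CommuteOffDiagonal c (b l)) → Kills (F ∘ contract η)
    Kills-∘-contract {F} lin kills {c} {η} eq comm l {ψ} alt u = begin
      F (contract η (contract (b l) ψ)) u
        ≈⟨ sym (eliminate lin kills eq (contract-Alt (b l) alt) u) ⟩
      F (contract c (contract (b l) ψ)) u
        ≈⟨ sym (+-vanishʳ (kills l (contract-Alt c alt) u)) ⟩
      F (contract c (contract (b l) ψ)) u + F (contract (b l) (contract c ψ)) u
        ≈⟨ sym (L.add _ _ u) ⟩
      F (λ v → contract c (contract (b l) ψ) v + contract (b l) (contract c ψ) v) u
        ≈⟨ L.zeros (contract-anticomm (comm l) alt) u ⟩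
      0# ∎
      where module L = Linear lin

    -- Replacement goes from left to right: each column already replaced is absorbed into `F`, which
    -- stays additive and still kills the b_l, while the columns not yet replaced form an
    -- alternating form.
    eliminateAll : ∀ {F} → Linear F → Kills F → ∀ k (c η : Fin k → Column N) (X : Fin k → Fin M → Carrier) →
      (∀ j → c j ≈ η j mod X j) → (∀ j l → CommuteOffDiagonal (c j) (b l)) →
      ∀ {ψ} → Alt ψ → ∀ u →
      F (contractAll (tabulate c) ψ) u ≈ F (contractAll (tabulate η) ψ) u
    eliminateAll lin kills zero    c η X eq comm alt u = refl
    eliminateAll lin kills (suc k) c η X eq comm alt u =
      trans (eliminate lin kills (eq zero) (contractAll-Alt (tabulate (c ∘ suc)) alt) u)
        (eliminateAll (Linear-∘-contract (η zero) lin)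
          (Kills-∘-contract lin kills (eq zero) (comm zero))
          k (c ∘ suc) (η ∘ suc) (X ∘ suc) (eq ∘ suc) (comm ∘ suc) alt u)

  -- Central elements and the Levi-Civita form

  Central : Carrier → Set (c ⊔ ℓ)
  Central z = ∀ r → z * r ≈ r * z

  *-Central : ∀ {y z} → Central y → Central z → Central (y * z)
  *-Central {y} {z} hy hz r = begin
    (y * z) * r  ≈⟨ *-assoc y z r ⟩
    y * (z * r)  ≈⟨ *-congˡ (hz r) ⟩
    y * (r * z)  ≈⟨ sym (*-assoc y r z) ⟩
    (y * r) * z  ≈⟨ *-congʳ (hy r) ⟩
    (r * y) * z  ≈⟨ *-assoc r y z ⟩
    r * (y * z)  ∎

  0-Central : Central 0#
  0-Central r = trans (zeroˡ r) (sym (zeroʳ r))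

  1-Central : Central 1#
  1-Central r = trans (*-identityˡ r) (sym (*-identityʳ r))

  -‿Central : ∀ {z} → Central z → Central (- z)
  -‿Central {z} h r = trans (sym (-‿distribˡ-* z r)) (trans (-‿cong (h r)) (-‿distribʳ-* r z))

  x∙yz≈y∙xz : ∀ {x y} z → x * y ≈ y * x → x * (y * z) ≈ y * (x * z)
  x∙yz≈y∙xz z h = trans (sym (*-assoc _ _ z)) (trans (*-congʳ h) (*-assoc _ _ z))

  -- The Levi-Civita symbol of a list of indices: ε u = Π_{i<j} χ(u_i, u_j),
  -- where χ(x, y) is the sign of y - x.
  χ : ∀ {N} → Fin N → Fin N → Carrier
  χ zero    zero    = 0#
  χ zero    (suc y) = 1#
  χ (suc x) zero    = - 1#
  χ (suc x) (suc y) = χ x y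

  χ* : ∀ {N} → Fin N → List (Fin N) → Carrier
  χ* x []      = 1#
  χ* x (y ∷ u) = χ x y * χ* x u

  ε : ∀ {N} → Form N
  ε []      = 1#
  ε (x ∷ u) = χ* x u * ε u

  χ-diagonal : ∀ {N} (x : Fin N) → χ x x ≈ 0#
  χ-diagonal zero    = refl
  χ-diagonal (suc x) = χ-diagonal x

  χ-antisym : ∀ {N} (x y : Fin N) → χ x y + χ y x ≈ 0#
  χ-antisym zero    zero    = +-identityˡ 0#
  χ-antisym zero    (suc y) = -‿inverseʳ 1#
  χ-antisym (suc x) zero    = -‿inverseˡ 1#
  χ-antisym (suc x) (suc y) = χ-antisym x y

  χ-< : ∀ {N} {x y : Fin N} → x Fin.< y → χ x y ≈ 1#
  χ-< {x = zero}  {suc y} _       = refl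
  χ-< {x = suc x} {suc y} (s≤s h) = χ-< h

  χ-Central : ∀ {N} (x y : Fin N) → Central (χ x y)
  χ-Central zero    zero    = 0-Central
  χ-Central zero    (suc y) = 1-Central
  χ-Central (suc x) zero    = -‿Central 1-Central
  χ-Central (suc x) (suc y) = χ-Central x y

  χ*-Central : ∀ {N} (x : Fin N) u → Central (χ* x u)
  χ*-Central x []      = 1-Central
  χ*-Central x (y ∷ u) = *-Central (χ-Central x y) (χ*-Central x u)

  ε-Central : ∀ {N} (u : List (Fin N)) → Central (ε u)
  ε-Central []      = 1-Central
  ε-Central (x ∷ u) = *-Central (χ*-Central x u) (ε-Central u)

  χ*-swap : ∀ {N} (z : Fin N) p x y q → χ* z (p ++ x ∷ y ∷ q) ≈ χ* z (p ++ y ∷ x ∷ q)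
  χ*-swap z []      x y q = x∙yz≈y∙xz _ (χ-Central z x _)
  χ*-swap z (w ∷ p) x y q = *-congˡ (χ*-swap z p x y q)

  χ*-∈ : ∀ {N} {x : Fin N} {u} → x ∈ u → χ* x u ≈ 0#
  χ*-∈ {x = x} (here ≡.refl) = *-vanishˡ (χ-diagonal x)
  χ*-∈ (there m)             = *-vanishʳ (χ*-∈ m)

  -- Exchanging neighbours `x` and `y` reorders the factors and alters only χ x y, which becomes χ y
  -- x. The reordering is allowed because signs are central.
  ε-Alt : ∀ {N} → Alt (ε {N})
  ε-Alt .repeat []      x q = *-vanishˡ (*-vanishˡ (χ-diagonal x))
  ε-Alt .repeat (z ∷ p) x q = *-vanishʳ (ε-Alt .repeat p x q)
  ε-Alt .swap [] x y q = begin
    (χ x y * X) * (Y * ε q) + (χ y x * Y) * (X * ε q)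
      ≈⟨ +-cong (*-assoc _ _ _) (*-assoc _ _ _) ⟩
    χ x y * (X * (Y * ε q)) + χ y x * (Y * (X * ε q))
      ≈⟨ +-congˡ (*-congˡ (x∙yz≈y∙xz _ (χ*-Central y q X))) ⟩
    χ x y * (X * (Y * ε q)) + χ y x * (X * (Y * ε q))
      ≈⟨ sym (distribʳ _ _ _) ⟩
    (χ x y + χ y x) * (X * (Y * ε q))
      ≈⟨ *-vanishˡ (χ-antisym x y) ⟩
    0# ∎
    where
    X Y : Carrier
    X = χ* x q
    Y = χ* y q
  ε-Alt .swap (z ∷ p) x y q =
    trans (+-congʳ (*-congʳ (χ*-swap z p x y q)))
      (trans (sym (distribˡ _ _ _)) (*-vanishʳ (ε-Alt .swap p x y q)))

  ε-++-zeroʳ : ∀ {N} (p : List (Fin N)) {u} → ε u ≈ 0# → ε (p ++ u) ≈ 0#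
  ε-++-zeroʳ []      h = h
  ε-++-zeroʳ (x ∷ p) h = *-vanishʳ (ε-++-zeroʳ p h)

  ε-lookup≡ : ∀ {N} (u : List (Fin N)) {i j} → i Fin.< j → lookup u i ≡ lookup u j → ε u ≈ 0#
  ε-lookup≡ (x ∷ u) {zero}  {suc j} _       eq =
    *-vanishˡ (χ*-∈ (subst (_∈ u) (≡.sym eq) (∈-lookup j)))
  ε-lookup≡ (x ∷ u) {suc i} {suc j} (s≤s h) eq = *-vanishʳ (ε-lookup≡ u h eq)

  ε-tabulate : ∀ {N K} (g : Fin K → Fin N) → (∀ {i j} → i Fin.< j → g i Fin.< g j) → ε (tabulate g) ≈ 1#
  ε-tabulate {K = zero}  g mono = refl
  ε-tabulate {K = suc K} g mono =
    trans (*-cong (χ*-tabulate (g ∘ suc) (λ i → mono (s≤s z≤n))) (ε-tabulate (g ∘ suc) (mono ∘ s≤s)))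
      (*-identityˡ 1#)
    where
    χ*-tabulate : ∀ {K x} (h : Fin K → Fin _) → (∀ i → x Fin.< h i) → χ* x (tabulate h) ≈ 1#
    χ*-tabulate {zero}  h lt = refl
    χ*-tabulate {suc K} h lt =
      trans (*-cong (χ-< (lt zero)) (χ*-tabulate (h ∘ suc) (lt ∘ suc))) (*-identityˡ 1#)

  -- Indices cut into a left and a right block

  module _ (n k : ℕ) where
    private
      left : Fin n → Fin (n +ℕ k)
      left = _↑ˡ k
      right : Fin k → Fin (n +ℕ k)
      right = n ↑ʳ_

    χ-left-left : ∀ x y → χ (left x) (left y) ≡ χ x y
    χ-left-left = go
      where
      go : ∀ {m} (x y : Fin m) → χ (x ↑ˡ k) (y ↑ˡ k) ≡ χ x y
      go zero    zero    = ≡.refl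
      go zero    (suc y) = ≡.refl
      go (suc x) zero    = ≡.refl
      go (suc x) (suc y) = go x y

    χ-right-right : ∀ x y → χ (right x) (right y) ≡ χ x y
    χ-right-right x y = go n
      where
      go : ∀ m → χ (m ↑ʳ x) (m ↑ʳ y) ≡ χ x y
      go zero    = ≡.refl
      go (suc m) = go m

    χ-left-right : ∀ x y → χ (left x) (right y) ≡ 1#
    χ-left-right x y = go x
      where
      go : ∀ {m} (x : Fin m) → χ (x ↑ˡ k) (m ↑ʳ y) ≡ 1#
      go zero    = ≡.refl
      go (suc x) = go x

    ε-map-right : ∀ v → ε (map right v) ≡ ε v
    ε-map-right []      = ≡.refl
    ε-map-right (x ∷ v) = ≡.cong₂ _*_ (go v) (ε-map-right v)
      where
      go : ∀ v → χ* (right x) (map right v) ≡ χ* x v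
      go []      = ≡.refl
      go (y ∷ v) = ≡.cong₂ _*_ (χ-right-right x y) (go v)

    ε-left-right : ∀ u v → ε (map left u ++ map right v) ≈ ε u * ε v
    ε-left-right []      v = trans (reflexive (ε-map-right v)) (sym (*-identityˡ _))
    ε-left-right (x ∷ u) v = trans (*-cong (go u) (ε-left-right u v)) (sym (*-assoc _ _ _))
      where
      go′ : ∀ v → χ* (left x) (map right v) ≈ 1#
      go′ []      = refl
      go′ (y ∷ v) = trans (*-cong (reflexive (χ-left-right x y)) (go′ v)) (*-identityˡ 1#)
      go : ∀ u → χ* (left x) (map left u ++ map right v) ≈ χ* x u
      go []      = go′ v
      go (y ∷ u) = *-cong (reflexive (χ-left-left x y)) (go u)

    -- There are k + 1 right indices with only k possible values. With `i` placed before `v`, the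
    -- collision is either between `i` and an entry of `v` or between two entries of `v`.
    ε-pigeonhole : ∀ p i q v → length v ≡ k → ε (p ++ right i ∷ (q ++ map right v)) ≈ 0#
    ε-pigeonhole p i q v eq
      with Finₚ.pigeonhole (s≤s (ℕₚ.≤-reflexive (≡.sym eq))) (lookup (i ∷ v))
    ... | zero  , suc b , _     , e = ε-++-zeroʳ p (*-vanishˡ (χ*-∈
            (∈-++⁺ʳ q (∈-map⁺ right (subst (_∈ v) (≡.sym e) (∈-lookup b))))))
    ... | suc a , suc b , s≤s h , e = ε-++-zeroʳ p (ε-++-zeroʳ (right i ∷ q)
            (trans (reflexive (ε-map-right v)) (ε-lookup≡ v h e)))

    -- A term that selects a left index contains a zero entry, so only right indices are appended
    -- and the columns may be truncated. The list `v` is general because the induction lengthens it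
    -- at its end.
    contractAll-right : ∀ K (η : Fin K → Column (n +ℕ k)) → (∀ j i → η j (left i) ≈ 0#) → ∀ ψ u v →
      contractAll (tabulate η) ψ (u ++ map right v) ≈
      contractAll (tabulate λ j → η j ∘ right) (λ w → ψ (u ++ map right w)) v
    contractAll-right zero    η zeros ψ u v = refl
    contractAll-right (suc K) η zeros ψ u v = begin
      ∑ (λ x → η zero x * Φ ((u ++ map right v) ∷ʳ x))
        ≈⟨ ∑-splitAt n _ ⟩
      ∑ (λ i → η zero (left i) * Φ ((u ++ map right v) ∷ʳ left i)) +
      ∑ (λ i → η zero (right i) * Φ ((u ++ map right v) ∷ʳ right i))
        ≈⟨ +-vanishˡ (∑-zero λ i → *-vanishˡ (zeros zero i)) ⟩
      ∑ (λ i → η zero (right i) * Φ ((u ++ map right v) ∷ʳ right i))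
        ≈⟨ ∑-cong (λ i → *-congˡ (trans (reflexive (≡.cong Φ (snoc i)))
             (contractAll-right K (η ∘ suc) (zeros ∘ suc) ψ u (v ∷ʳ i)))) ⟩
      contractAll (tabulate λ j → η j ∘ right) (λ w → ψ (u ++ map right w)) v ∎
      where
      Φ : Form (n +ℕ k)
      Φ = contractAll (tabulate (η ∘ suc)) ψ
      snoc : ∀ i → (u ++ map right v) ∷ʳ right i ≡ u ++ map right (v ∷ʳ i)
      snoc i = ≡.trans (Listₚ.++-assoc u (map right v) _)
                 (≡.cong (u ++_) (≡.sym (Listₚ.map-++ right v (i ∷ []))))

    VanishesOnRight : Form (n +ℕ k) → Set ℓ
    VanishesOnRight ψ = ∀ p i q → ψ (p ++ right i ∷ q) ≈ 0#

    contractAll-VanishesOnRight : ∀ cs {ψ} → VanishesOnRight ψ → VanishesOnRight (contractAll cs ψ)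
    contractAll-VanishesOnRight []       van = van
    contractAll-VanishesOnRight (c ∷ cs) {ψ} van p i q = ∑-zero λ x → *-vanishʳ
      (trans (reflexive (≡.cong (contractAll cs ψ) (Listₚ.++-assoc p (right i ∷ q) _)))
        (contractAll-VanishesOnRight cs van p i (q ∷ʳ x)))

    -- Opposite mechanism to `contractAll-right`: the lower entries of the columns are arbitrary,
    -- and it is the form that rejects right indices.
    contractAll-left : ∀ K (b : Fin K → Column (n +ℕ k)) {ψ} → VanishesOnRight ψ → ∀ u →
      contractAll (tabulate b) ψ (map left u) ≈
      contractAll (tabulate λ j → b j ∘ left) (ψ ∘ map left) u
    contractAll-left zero    b van u = refl
    contractAll-left (suc K) b {ψ} van u = begin
      ∑ (λ x → b zero x * Φ (map left u ∷ʳ x))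
        ≈⟨ ∑-splitAt n _ ⟩
      ∑ (λ i → b zero (left i) * Φ (map left u ∷ʳ left i)) +
      ∑ (λ i → b zero (right i) * Φ (map left u ∷ʳ right i))
        ≈⟨ +-vanishʳ (∑-zero λ i → *-vanishʳ
             (contractAll-VanishesOnRight (tabulate (b ∘ suc)) van (map left u) i [])) ⟩
      ∑ (λ i → b zero (left i) * Φ (map left u ∷ʳ left i))
        ≈⟨ ∑-cong (λ i → *-congˡ
             (trans (reflexive (≡.cong Φ (≡.sym (Listₚ.map-++ left u (i ∷ [])))))
               (contractAll-left K (b ∘ suc) van (u ∷ʳ i)))) ⟩
      contractAll (tabulate λ j → b j ∘ left) (ψ ∘ map left) u ∎
      where
      Φ : Form (n +ℕ k)
      Φ = contractAll (tabulate (b ∘ suc)) ψ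

  -- Determinants and the Schur factorization

  Matrix : ℕ → Set c
  Matrix N = Fin N → Fin N → Carrier

  column : ∀ {N} → Matrix N → Fin N → Column N
  column b j i = b i j

  -- Expanded from the empty list, this is the sum over all index lists x of b_{x1 1} ⋯ b_{xN N}
  -- ε(x), the Leibniz sum in column order with vanishing terms for lists that repeat an index.
  Det : ∀ {N} → Matrix N → Carrier
  Det b = contractAll (tabulate (column b)) ε []

  contractAll-cong-columns : ∀ {N} K {a b : Fin K → Column N} → (∀ j i → a j i ≈ b j i) → ∀ ψ →
    contractAll (tabulate a) ψ ≋ contractAll (tabulate b) ψ
  contractAll-cong-columns zero    h ψ u = refl
  contractAll-cong-columns (suc K) h ψ u =
    ∑-cong λ x → *-cong (h zero x) (contractAll-cong-columns K (h ∘ suc) ψ _)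

  Det-cong : ∀ {N} {a b : Matrix N} → (∀ i j → a i j ≈ b i j) → Det a ≈ Det b
  Det-cong {N} h = contractAll-cong-columns N (λ j i → h i j) ε []

  ∑-single : ∀ {N} (f : Fin N → Carrier) j → (∀ i → i ≢ j → f i ≈ 0#) → ∑ f ≈ f j
  ∑-single f zero    h = trans (∑-suc f) (+-vanishʳ (∑-zero λ i → h (suc i) λ ()))
  ∑-single f (suc j) h = trans (∑-suc f) (trans (+-vanishˡ (h zero λ ()))
    (∑-single (f ∘ suc) j λ i i≢j → h (suc i) (i≢j ∘ Finₚ.suc-injective)))

  Det-identity : ∀ {N} {b : Matrix N} → (∀ i → b i i ≈ 1#) → (∀ {i j} → i ≢ j → b i j ≈ 0#) → Det b ≈ 1#
  Det-identity {N} {b} diag off =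
    trans (go N (λ i → i) []) (ε-tabulate {N} (λ i → i) (λ h → h))
    where
    go : ∀ K (g : Fin K → Fin N) u → contractAll (tabulate (column b ∘ g)) ε u ≈ ε (u ++ tabulate g)
    go zero    g u = reflexive (≡.cong ε (≡.sym (Listₚ.++-identityʳ u)))
    go (suc K) g u =
      trans (∑-single _ (g zero) λ i i≢ → *-vanishˡ (off i≢))
        (trans (trans (*-congʳ (diag (g zero))) (*-identityˡ _))
          (trans (go K (g ∘ suc) (u ∷ʳ g zero)) (reflexive (≡.cong ε (Listₚ.++-assoc u _ _)))))

  Det-1×1 : (b : Matrix 1) → Det b ≈ b zero zero
  Det-1×1 b = begin
    ∑ (λ x → b x zero * ε (x ∷ []))  ≈⟨ ∑-single _ zero (λ { zero 0≢0 → contradiction ≡.refl 0≢0 ; (suc ()) _ }) ⟩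
    b zero zero * (1# * 1#)          ≈⟨ *-congˡ (*-identityˡ 1#) ⟩
    b zero zero * 1#                 ≈⟨ *-identityʳ _ ⟩
    b zero zero                      ∎

  RowsCommute : ∀ {N} → Matrix N → Set ℓ
  RowsCommute b = ∀ {x y} → x ≢ y → ∀ l l′ → b x l * b y l′ ≈ b y l′ * b x l

  tabulate-splitAt : ∀ {a} {A : Set a} n {k} (f : Fin (n +ℕ k) → A) →
    tabulate f ≡ tabulate (λ i → f (i ↑ˡ k)) ++ tabulate (λ j → f (n ↑ʳ j))
  tabulate-splitAt zero    f = ≡.refl
  tabulate-splitAt (suc n) f = ≡.cong (f zero ∷_) (tabulate-splitAt n (f ∘ suc))

  -- `X` stands for the inverse of the corner times the upper right block, but only through the
  -- equation `solves`. It makes the upper entries of `η` zero, and the lower ones the Schur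
  -- complement.
  module Schur (n k : ℕ) (b : Matrix (n +ℕ k)) (rows : RowsCommute b) (X : Fin n → Fin k → Carrier)
    (solves : ∀ i j → b (i ↑ˡ k) (n ↑ʳ j) ≈ ∑ λ l → b (i ↑ˡ k) (l ↑ˡ k) * X l j)
    where

    η : Fin k → Column (n +ℕ k)
    η j x = b x (n ↑ʳ j) - ∑ λ l → b x (l ↑ˡ k) * X l j

    corner : Matrix n
    corner i j = b (i ↑ˡ k) (j ↑ˡ k)

    complement : Matrix k
    complement i j = η j (n ↑ʳ i)

    private
      B : Fin n → Column (n +ℕ k)
      B l = column b (l ↑ˡ k)
      Ψ : Form (n +ℕ k)
      Ψ = contractAll (tabulate η) ε

    open Elimination B

    B-Kills : Kills (contractAll (tabulate B))
    B-Kills l alt = contractAll-member (tabulate B) (∈-tabulate⁺ l) commute alt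
      where
      commute : ∀ {c} → c ∈ tabulate B → CommuteOffDiagonal (B l) c
      commute m with ∈-tabulate⁻ m
      ... | _ , ≡.refl = λ x y x≢y → rows x≢y _ _

    η-left : ∀ j i → η j (i ↑ˡ k) ≈ 0#
    η-left j i = trans (+-congʳ (solves i j)) (-‿inverseʳ _)

    Ψ-expand : ∀ u → Ψ u ≈
      contractAll (tabulate (column complement)) (λ w → ε (u ++ map (n ↑ʳ_) w)) []
    Ψ-expand u = trans (reflexive (≡.cong Ψ (≡.sym (Listₚ.++-identityʳ u))))
      (contractAll-right n k k η η-left ε u [])

    -- The k columns in `Ψ` append k right indices of their own, so one right index already present
    -- is one too many.
    Ψ-VanishesOnRight : VanishesOnRight n k Ψ
    Ψ-VanishesOnRight p i q = trans (Ψ-expand (p ++ (n ↑ʳ i) ∷ q))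
      (trans (contractAll-cong-length E {φ = λ _ → 0#} [] λ w eq →
          trans (reflexive (≡.cong ε (Listₚ.++-assoc p ((n ↑ʳ i) ∷ q) _)))
            (ε-pigeonhole n k p i q w (≡.trans eq (Listₚ.length-tabulate (column complement)))))
        (contractAll-zero E (λ _ → refl) []))
      where
      E : List (Column k)
      E = tabulate (column complement)

    Ψ-left : ∀ u → Ψ (map (_↑ˡ k) u) ≈ ε u * Det complement
    Ψ-left u = begin
      Ψ (map (_↑ˡ k) u)
        ≈⟨ Ψ-expand (map (_↑ˡ k) u) ⟩
      contractAll E (λ w → ε (map (_↑ˡ k) u ++ map (n ↑ʳ_) w)) []
        -- Entries of the complement multiply from the left, so `ε u` can leave the contraction only
        -- on the right; centrality moves it there and, at the end, back.
        ≈⟨ contractAll-cong E (λ w → trans (ε-left-right n k u w) (ε-Central u _)) [] ⟩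
      contractAll E (λ w → ε w * ε u) []
        ≈⟨ contractAll-*ʳ E ε (ε u) [] ⟩
      Det complement * ε u
        ≈⟨ sym (ε-Central u _) ⟩
      ε u * Det complement ∎
      where
      E : List (Column k)
      E = tabulate (column complement)

    Det-factor : Det b ≈ Det corner * Det complement
    Det-factor = begin
      contractAll (tabulate (column b)) ε []
        ≡⟨ ≡.cong (λ cs → contractAll cs ε []) (tabulate-splitAt n (column b)) ⟩
      contractAll (tabulate B ++ tabulate C) ε []
        ≡⟨ ≡.cong (λ F → F []) (contractAll-++ (tabulate B) (tabulate C) ε) ⟩
      contractAll (tabulate B) (contractAll (tabulate C) ε) []
        ≈⟨ eliminateAll (contractAll-Linear (tabulate B)) B-Kills k C η (λ j l → X l j)
             (λ j x → sym (trans (+-assoc _ _ _) (+-vanishʳ (-‿inverseˡ _))))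
             (λ j l x y x≢y → rows x≢y _ _) ε-Alt [] ⟩
      contractAll (tabulate B) Ψ []
        -- The columns `B` still have their lower entries; these drop out because `Ψ` vanishes on
        -- right indices.
        ≈⟨ contractAll-left n k n B Ψ-VanishesOnRight [] ⟩
      contractAll (tabulate (column corner)) (Ψ ∘ map (_↑ˡ k)) []
        ≈⟨ contractAll-cong (tabulate (column corner)) Ψ-left [] ⟩
      contractAll (tabulate (column corner)) (λ u → ε u * Det complement) []
        ≈⟨ contractAll-*ʳ (tabulate (column corner)) ε _ [] ⟩
      Det corner * Det complement ∎
      where
      C : Fin k → Column (n +ℕ k)
      C j = column b (n ↑ʳ j)

-- The ring of noncommutative power series

module SeriesAlgebra {c ℓ} (K : CommutativeRing c ℓ) (m : ℕ) where
  open CommutativeRing K hiding (zero)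
  open WithRing K
  open Alternating ring using (∑; ∑-cong; ∑-suc; ∑-empty; ∑-single; +-interchange; +-vanish; +-vanishˡ; +-vanishʳ; *-vanishˡ; *-vanishʳ)
  open import Algebra.Properties.Ring ring
  open import Relation.Binary.Reasoning.Setoid setoid

  infix 4 _≐_
  _≐_ : Series m → Series m → Set ℓ
  f ≐ g = ∀ w → f w ≈ g w

  ∂ : Letter m → Series m → Series m
  ∂ x f w = f (x ∷ w)

  ∂ʳ : Letter m → Series m → Series m
  ∂ʳ x f w = f (w ∷ʳ x)

  *S-[] : ∀ (f g : Series m) → (f *S g) [] ≈ f [] * g []
  *S-[] f g = +-identityʳ _

  -- A split of `x ∷ w` has an empty left part or one that begins with `x`. Through this rule the
  -- ring laws become inductions on words, with `∂ x f` in place of `f`.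
  *S-∷ : ∀ (f g : Series m) x w → (f *S g) (x ∷ w) ≈ f [] * g (x ∷ w) + (∂ x f *S g) w
  *S-∷ f g x w = +-congˡ (reflexive (≡.cong ΣR (≡.sym (Listₚ.map-∘ (splits w)))))

  *S-cong : ∀ {f f′ g g′} → f ≐ f′ → g ≐ g′ → f *S g ≐ f′ *S g′
  *S-cong {f} {f′} {g} {g′} p q [] = +-congʳ (*-cong (p []) (q []))
  *S-cong {f} {f′} {g} {g′} p q (x ∷ w) = begin
    (f *S g) (x ∷ w)                             ≈⟨ *S-∷ f g x w ⟩
    f [] * g (x ∷ w) + (∂ x f *S g) w            ≈⟨ +-cong (*-cong (p []) (q (x ∷ w))) (*S-cong (p ∘ (x ∷_)) q w) ⟩
    f′ [] * g′ (x ∷ w) + (∂ x f′ *S g′) w        ≈⟨ sym (*S-∷ f′ g′ x w) ⟩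
    (f′ *S g′) (x ∷ w)                           ∎

  *S-zeroˡ : ∀ {f : Series m} g → f ≐ 0S → f *S g ≐ 0S
  *S-zeroˡ {f} g h []      = trans (*S-[] f g) (*-vanishˡ (h []))
  *S-zeroˡ {f} g h (x ∷ w) = trans (*S-∷ f g x w) (+-vanish (*-vanishˡ (h [])) (*S-zeroˡ g (h ∘ (x ∷_)) w))

  *S-distribʳ : ∀ (h f g : Series m) → (f +S g) *S h ≐ (f *S h) +S (g *S h)
  *S-distribʳ h f g [] = begin
    ((f +S g) *S h) []             ≈⟨ *S-[] (f +S g) h ⟩
    (f [] + g []) * h []           ≈⟨ distribʳ _ _ _ ⟩
    f [] * h [] + g [] * h []      ≈⟨ sym (+-cong (*S-[] f h) (*S-[] g h)) ⟩
    (f *S h) [] + (g *S h) []      ∎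
  *S-distribʳ h f g (x ∷ w) = begin
    ((f +S g) *S h) (x ∷ w)
      ≈⟨ *S-∷ (f +S g) h x w ⟩
    (f [] + g []) * h (x ∷ w) + ((∂ x f +S ∂ x g) *S h) w
      ≈⟨ +-cong (distribʳ _ _ _) (*S-distribʳ h (∂ x f) (∂ x g) w) ⟩
    (f [] * h (x ∷ w) + g [] * h (x ∷ w)) + ((∂ x f *S h) w + (∂ x g *S h) w)
      ≈⟨ +-interchange _ _ _ _ ⟩
    (f [] * h (x ∷ w) + (∂ x f *S h) w) + (g [] * h (x ∷ w) + (∂ x g *S h) w)
      ≈⟨ sym (+-cong (*S-∷ f h x w) (*S-∷ g h x w)) ⟩
    ((f *S h) +S (g *S h)) (x ∷ w) ∎

  *S-distribˡ : ∀ (f g h : Series m) → f *S (g +S h) ≐ (f *S g) +S (f *S h)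
  *S-distribˡ f g h [] = begin
    (f *S (g +S h)) []             ≈⟨ *S-[] f (g +S h) ⟩
    f [] * (g [] + h [])           ≈⟨ distribˡ _ _ _ ⟩
    f [] * g [] + f [] * h []      ≈⟨ sym (+-cong (*S-[] f g) (*S-[] f h)) ⟩
    (f *S g) [] + (f *S h) []      ∎
  *S-distribˡ f g h (x ∷ w) = begin
    (f *S (g +S h)) (x ∷ w)
      ≈⟨ *S-∷ f (g +S h) x w ⟩
    f [] * (g (x ∷ w) + h (x ∷ w)) + (∂ x f *S (g +S h)) w
      ≈⟨ +-cong (distribˡ _ _ _) (*S-distribˡ (∂ x f) g h w) ⟩
    (f [] * g (x ∷ w) + f [] * h (x ∷ w)) + ((∂ x f *S g) w + (∂ x f *S h) w)
      ≈⟨ +-interchange _ _ _ _ ⟩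
    (f [] * g (x ∷ w) + (∂ x f *S g) w) + (f [] * h (x ∷ w) + (∂ x f *S h) w)
      ≈⟨ sym (+-cong (*S-∷ f g x w) (*S-∷ f h x w)) ⟩
    ((f *S g) +S (f *S h)) (x ∷ w) ∎

  scale-*S : ∀ r (f g : Series m) → scale r f *S g ≐ scale r (f *S g)
  scale-*S r f g [] = begin
    (scale r f *S g) []   ≈⟨ *S-[] (scale r f) g ⟩
    (r * f []) * g []     ≈⟨ *-assoc _ _ _ ⟩
    r * (f [] * g [])     ≈⟨ *-congˡ (sym (*S-[] f g)) ⟩
    r * (f *S g) []       ∎
  scale-*S r f g (x ∷ w) = begin
    (scale r f *S g) (x ∷ w)                            ≈⟨ *S-∷ (scale r f) g x w ⟩
    (r * f []) * g (x ∷ w) + (scale r (∂ x f) *S g) w   ≈⟨ +-cong (*-assoc _ _ _) (scale-*S r (∂ x f) g w) ⟩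
    r * (f [] * g (x ∷ w)) + r * (∂ x f *S g) w         ≈⟨ sym (distribˡ _ _ _) ⟩
    r * (f [] * g (x ∷ w) + (∂ x f *S g) w)             ≈⟨ *-congˡ (sym (*S-∷ f g x w)) ⟩
    r * (f *S g) (x ∷ w)                                ∎

  *S-assoc : ∀ (f g h : Series m) → (f *S g) *S h ≐ f *S (g *S h)
  *S-assoc f g h [] = begin
    ((f *S g) *S h) []        ≈⟨ *S-[] (f *S g) h ⟩
    (f *S g) [] * h []        ≈⟨ *-congʳ (*S-[] f g) ⟩
    (f [] * g []) * h []      ≈⟨ *-assoc _ _ _ ⟩
    f [] * (g [] * h [])      ≈⟨ *-congˡ (sym (*S-[] g h)) ⟩
    f [] * (g *S h) []        ≈⟨ sym (*S-[] f (g *S h)) ⟩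
    (f *S (g *S h)) []        ∎
  *S-assoc f g h (x ∷ w) = begin
    ((f *S g) *S h) (x ∷ w)
      ≈⟨ *S-∷ (f *S g) h x w ⟩
    (f *S g) [] * h (x ∷ w) + (∂ x (f *S g) *S h) w
      ≈⟨ +-cong (trans (*-congʳ (*S-[] f g)) (*-assoc _ _ _))
           (*S-cong {g = h} (*S-∷ f g x) (λ _ → refl) w) ⟩
    f [] * (g [] * h (x ∷ w)) + ((scale (f []) (∂ x g) +S (∂ x f *S g)) *S h) w
      ≈⟨ +-congˡ (trans (*S-distribʳ h (scale (f []) (∂ x g)) (∂ x f *S g) w)
           (+-cong (scale-*S (f []) (∂ x g) h w) (*S-assoc (∂ x f) g h w))) ⟩
    f [] * (g [] * h (x ∷ w)) + (f [] * (∂ x g *S h) w + (∂ x f *S (g *S h)) w)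
      ≈⟨ sym (+-assoc _ _ _) ⟩
    (f [] * (g [] * h (x ∷ w)) + f [] * (∂ x g *S h) w) + (∂ x f *S (g *S h)) w
      ≈⟨ +-congʳ (trans (sym (distribˡ _ _ _)) (*-congˡ (sym (*S-∷ g h x w)))) ⟩
    f [] * (g *S h) (x ∷ w) + (∂ x f *S (g *S h)) w
      ≈⟨ sym (*S-∷ f (g *S h) x w) ⟩
    (f *S (g *S h)) (x ∷ w) ∎

  *S-identityˡ : ∀ (f : Series m) → 1S *S f ≐ f
  *S-identityˡ f []      = trans (*S-[] 1S f) (*-identityˡ _)
  *S-identityˡ f (x ∷ w) = trans (*S-∷ 1S f x w)
    (trans (+-cong (*-identityˡ _) (*S-zeroˡ f (λ _ → refl) w)) (+-identityʳ _))

  *S-identityʳ : ∀ (f : Series m) → f *S 1S ≐ f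
  *S-identityʳ f []      = trans (*S-[] f 1S) (*-identityʳ _)
  *S-identityʳ f (x ∷ w) = trans (*S-∷ f 1S x w)
    (trans (+-cong (zeroʳ _) (*S-identityʳ (∂ x f) w)) (+-identityˡ _))

  -- Since `splits` recurses on the first letter, the rule for the last letter takes an induction.
  -- It serves the closure of the ideal under multiplication from the right.
  *S-∷ʳ : ∀ (f g : Series m) w x → (f *S g) (w ∷ʳ x) ≈ f (w ∷ʳ x) * g [] + (f *S ∂ʳ x g) w
  *S-∷ʳ f g [] x = begin
    (f *S g) (x ∷ [])                              ≈⟨ *S-∷ f g x [] ⟩
    f [] * g (x ∷ []) + (∂ x f *S g) []            ≈⟨ +-cong (sym (*S-[] f (∂ʳ x g))) (*S-[] (∂ x f) g) ⟩
    (f *S ∂ʳ x g) [] + f (x ∷ []) * g []           ≈⟨ +-comm _ _ ⟩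
    f (x ∷ []) * g [] + (f *S ∂ʳ x g) []           ∎
  *S-∷ʳ f g (y ∷ w) x = begin
    (f *S g) (y ∷ (w ∷ʳ x))
      ≈⟨ *S-∷ f g y (w ∷ʳ x) ⟩
    f [] * g (y ∷ (w ∷ʳ x)) + (∂ y f *S g) (w ∷ʳ x)
      ≈⟨ +-congˡ (trans (*S-∷ʳ (∂ y f) g w x) (+-comm _ _)) ⟩
    f [] * g (y ∷ (w ∷ʳ x)) + ((∂ y f *S ∂ʳ x g) w + f (y ∷ (w ∷ʳ x)) * g [])
      ≈⟨ trans (sym (+-assoc _ _ _)) (+-comm _ _) ⟩
    f (y ∷ (w ∷ʳ x)) * g [] + (f [] * g (y ∷ (w ∷ʳ x)) + (∂ y f *S ∂ʳ x g) w)
      ≈⟨ +-congˡ (sym (*S-∷ f (∂ʳ x g) y w)) ⟩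
    f (y ∷ (w ∷ʳ x)) * g [] + (f *S ∂ʳ x g) (y ∷ w) ∎

  -- Monomials and the Cartier-Foata ideal

  δ-refl : ∀ {u v : Word m} → u ≡ v → δ u v ≡ 1#
  δ-refl {u} {v} eq with u ≟W v
  ... | yes _  = ≡.refl
  ... | no u≢v = contradiction eq u≢v

  δ-≢ : ∀ {u v : Word m} → u ≢ v → δ u v ≡ 0#
  δ-≢ {u} {v} u≢v with u ≟W v
  ... | yes eq = contradiction eq u≢v
  ... | no _   = ≡.refl

  δ-injective : (e : Word m → Word m) → (∀ {u v} → e u ≡ e v → u ≡ v) → ∀ u v → δ (e u) (e v) ≡ δ u v
  δ-injective e inj u v with u ≟W v
  ... | yes eq = δ-refl (≡.cong e eq)
  ... | no u≢v = δ-≢ (u≢v ∘ inj)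

  δ-*S-δ : ∀ u v → δ u *S δ v ≐ δ (u ++ v)
  δ-*S-δ []      v w       = *S-identityˡ (δ v) w
  δ-*S-δ (x ∷ u) v []      = trans (*S-[] (δ (x ∷ u)) (δ v)) (zeroˡ _)
  δ-*S-δ (x ∷ u) v (y ∷ w) = begin
    (δ (x ∷ u) *S δ v) (y ∷ w)                 ≈⟨ *S-∷ (δ (x ∷ u)) (δ v) y w ⟩
    0# * δ v (y ∷ w) + (∂ y (δ (x ∷ u)) *S δ v) w ≈⟨ +-vanishˡ (zeroˡ _) ⟩
    (∂ y (δ (x ∷ u)) *S δ v) w                 ≈⟨ tail (×-≡-dec Finₚ._≟_ Finₚ._≟_ x y) ⟩
    δ (x ∷ u ++ v) (y ∷ w)                     ∎
    where
    tail : Dec (x ≡ y) → (∂ y (δ (x ∷ u)) *S δ v) w ≈ δ (x ∷ u ++ v) (y ∷ w)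
    tail (yes ≡.refl) = begin
      (∂ x (δ (x ∷ u)) *S δ v) w  ≈⟨ *S-cong {g = δ v} (λ t → reflexive (δ-injective (x ∷_) Listₚ.∷-injectiveʳ u t)) (λ _ → refl) w ⟩
      (δ u *S δ v) w              ≈⟨ δ-*S-δ u v w ⟩
      δ (u ++ v) w                ≡⟨ δ-injective (x ∷_) Listₚ.∷-injectiveʳ (u ++ v) w ⟨
      δ (x ∷ u ++ v) (x ∷ w)      ∎
    tail (no x≢y) = trans
      (*S-zeroˡ (δ v) (λ t → reflexive (δ-≢ (x≢y ∘ Listₚ.∷-injectiveˡ))) w)
      (reflexive (≡.sym (δ-≢ (x≢y ∘ Listₚ.∷-injectiveˡ))))

  -- One degree of `InCFIdeal`. The finite list of terms may change with the degree, so closure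
  -- properties are proved degree by degree.
  IdealAt : ℕ → Series m → Set (c ⊔ ℓ)
  IdealAt d h = Σ (List CFTerm) λ ts → ∀ w → length w ≡ d → h w ≈ ΣS (map termS ts) w

  IdealAt-cong : ∀ {d h h′} → (∀ w → length w ≡ d → h′ w ≈ h w) → IdealAt d h → IdealAt d h′
  IdealAt-cong eq (ts , e) = ts , λ w l → trans (eq w l) (e w l)

  IdealAt-0 : ∀ {d} → IdealAt d 0S
  IdealAt-0 = [] , λ _ _ → refl

  IdealAt-+ : ∀ {d h h′} → IdealAt d h → IdealAt d h′ → IdealAt d (h +S h′)
  IdealAt-+ (ts , e) (us , e′) = ts ++ us , λ w l → trans (+-cong (e w l) (e′ w l)) (sym (go ts w))
    where
    go : ∀ ts w → ΣS (map termS (ts ++ us)) w ≈ ΣS (map termS ts) w + ΣS (map termS us) w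
    go []       w = sym (+-identityˡ _)
    go (t ∷ ts) w = trans (+-congˡ (go ts w)) (sym (+-assoc _ _ _))

  IdealAt-scale : ∀ {d h} r → IdealAt d h → IdealAt d (scale r h)
  IdealAt-scale r (ts , e) = map scaled ts , λ w l → trans (*-congˡ (e w l)) (go ts w)
    where
    scaled : CFTerm → CFTerm
    scaled t = record { CFTerm t ; coef = r * CFTerm.coef t }
    go : ∀ ts w → r * ΣS (map termS ts) w ≈ ΣS (map termS (map scaled ts)) w
    go []       w = zeroʳ r
    go (t ∷ ts) w = trans (distribˡ _ _ _) (+-cong (sym (*-assoc _ _ _)) (go ts w))

  IdealAt-∑ : ∀ {d N} {F : Fin N → Series m} → (∀ i → IdealAt d (F i)) → IdealAt d (λ w → ∑ λ i → F i w)
  IdealAt-∑ {N = zero}  h = IdealAt-cong (λ w _ → ∑-empty _) IdealAt-0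
  IdealAt-∑ {N = suc N} h = IdealAt-cong (λ w _ → ∑-suc _) (IdealAt-+ (h zero) (IdealAt-∑ (h ∘ suc)))

  xyWord yxWord : CFTerm → Word m
  xyWord t = CFTerm.left t ++ CFTerm.x t ∷ CFTerm.y t ∷ CFTerm.right t
  yxWord t = CFTerm.left t ++ CFTerm.y t ∷ CFTerm.x t ∷ CFTerm.right t

  -- ext prepends or appends a letter, so that the two-sidedness of the ideal
  -- is proved once for both sides.
  module Extension (ext : Letter m → Word m → Word m)
    (ext-injective : ∀ {x y u v} → ext x u ≡ ext y v → x ≡ y × u ≡ v)
    (ext-covers : ∀ {d} w → length w ≡ suc d → ∃ λ x → ∃ λ u → w ≡ ext x u × length u ≡ d)
    (extTerm : Letter m → CFTerm → CFTerm)
    (termS-ext : ∀ z t →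
       termS (extTerm z t) ≐ scale (CFTerm.coef t) (δ (ext z (xyWord t)) -S δ (ext z (yxWord t))))
    where

    termS-ext-same : ∀ z t w → termS (extTerm z t) (ext z w) ≈ termS t w
    termS-ext-same z t w = trans (termS-ext z t (ext z w)) (*-congˡ (+-cong
        (reflexive (δ-injective (ext z) (proj₂ ∘ ext-injective) _ w))
        (-‿cong (reflexive (δ-injective (ext z) (proj₂ ∘ ext-injective) _ w)))))

    termS-ext-other : ∀ {z z′} → z ≢ z′ → ∀ t w → termS (extTerm z t) (ext z′ w) ≈ 0#
    termS-ext-other z≢z′ t w = trans (termS-ext _ t (ext _ w)) (*-vanishʳ (trans (+-cong
        (reflexive (δ-≢ (z≢z′ ∘ proj₁ ∘ ext-injective)))
        (-‿cong (reflexive (δ-≢ (z≢z′ ∘ proj₁ ∘ ext-injective)))))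
      (-‿inverseʳ 0#)))

    -- A word of length d + 1 is `ext x u` for exactly one letter `x`, and there are finitely many
    -- letters. So the lists for all letters are extended and added; at `ext z u` only the terms of
    -- `z` survive.
    IdealAt-ext : ∀ {d g} → (∀ x → IdealAt d (g ∘ ext x)) → IdealAt (suc d) g
    IdealAt-ext {d} {g} h = IdealAt-cong eq (IdealAt-∑ λ i → IdealAt-∑ λ j → piece (i , j))
      where
      part : Letter m → Series m
      part x = ΣS (map termS (map (extTerm x) (proj₁ (h x))))
      piece : ∀ x → IdealAt (suc d) (part x)
      piece x = map (extTerm x) (proj₁ (h x)) , λ _ _ → refl
      same : ∀ z w ts → ΣS (map termS (map (extTerm z) ts)) (ext z w) ≈ ΣS (map termS ts) w
      same z w []       = refl
      same z w (t ∷ ts) = +-cong (termS-ext-same z t w) (same z w ts)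
      other : ∀ {z z′} → z ≢ z′ → ∀ w ts → ΣS (map termS (map (extTerm z) ts)) (ext z′ w) ≈ 0#
      other z≢z′ w []       = refl
      other z≢z′ w (t ∷ ts) = +-vanish (termS-ext-other z≢z′ t w) (other z≢z′ w ts)
      eq : ∀ w → length w ≡ suc d → g w ≈ ∑ λ i → ∑ λ j → part (i , j) w
      eq w l with ext-covers w l
      ... | (i , j) , u , ≡.refl , l′ = begin
        g (ext (i , j) u)
          ≈⟨ proj₂ (h (i , j)) u l′ ⟩
        ΣS (map termS (proj₁ (h (i , j)))) u
          ≈⟨ sym (same (i , j) u (proj₁ (h (i , j)))) ⟩
        part (i , j) (ext (i , j) u)
          ≈⟨ sym (∑-single (λ j′ → part (i , j′) (ext (i , j) u)) j
               (λ j′ j′≢j → other (j′≢j ∘ ≡.cong proj₂) u (proj₁ (h (i , j′))))) ⟩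
        ∑ (λ j′ → part (i , j′) (ext (i , j) u))
          ≈⟨ sym (∑-single (λ i′ → ∑ λ j′ → part (i′ , j′) (ext (i , j) u)) i
               (λ i′ i′≢i → Alternating.∑-zero ring
                 λ j′ → other (i′≢i ∘ ≡.cong proj₁) u (proj₁ (h (i′ , j′))))) ⟩
        ∑ (λ i′ → ∑ λ j′ → part (i′ , j′) (ext (i , j) u)) ∎

  IdealAt-∷ : ∀ {d g} → (∀ x → IdealAt d (∂ x g)) → IdealAt (suc d) g
  IdealAt-∷ = Extension.IdealAt-ext _∷_ Listₚ.∷-injective
    (λ { (x ∷ u) l → x , u , ≡.refl , ℕₚ.suc-injective l })
    (λ z t → record { CFTerm t ; left = z ∷ CFTerm.left t })
    (λ z t w → refl)

  IdealAt-∷ʳ : ∀ {d g} → (∀ x → IdealAt d (∂ʳ x g)) → IdealAt (suc d) g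
  IdealAt-∷ʳ {g = g} = Extension.IdealAt-ext (λ x u → u ∷ʳ x)
    (λ {x} {y} {u} {v} eq → let p , q = Listₚ.∷ʳ-injective u v eq in q , p)
    covers
    (λ z t → record { CFTerm t ; right = CFTerm.right t ∷ʳ z })
    (λ z t w → let open CFTerm t in
      *-congˡ (+-cong (reflexive (≡.cong (λ v → δ v w) (≡.sym (Listₚ.++-assoc left (x ∷ y ∷ right) _))))
        (-‿cong (reflexive (≡.cong (λ v → δ v w) (≡.sym (Listₚ.++-assoc left (y ∷ x ∷ right) _)))))))
    where
    covers : ∀ {d} (w : Word m) → length w ≡ suc d → ∃ λ x → ∃ λ u → w ≡ u ∷ʳ x × length u ≡ d
    covers w l with initLast w
    covers .[] () | []
    covers .(u ∷ʳ x) l | u ∷ʳ′ x = x , u , ≡.refl ,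
      ℕₚ.suc-injective (≡.trans (≡.sym (≡.trans (Listₚ.length-++ u) (ℕₚ.+-comm (length u) 1))) l)

  -- An arbitrary series is no finite combination of words, hence the induction on the degree: f h =
  -- f[] h + Σ_x x (∂_x f) h, where the first summand is a scalar multiple and the others only need
  -- (∂_x f) h one degree lower.
  IdealAt-*ˡ : ∀ {h} → InCFIdeal h → ∀ d f → IdealAt d (f *S h)
  IdealAt-*ˡ {h} ideal zero    f = IdealAt-cong (λ { [] _ → *S-[] f h ; (_ ∷ _) () }) (IdealAt-scale (f []) (ideal zero))
  IdealAt-*ˡ {h} ideal (suc d) f =
    IdealAt-cong (λ w _ → sym (trans (+-comm _ _) (trans (+-assoc _ _ _) (+-vanishʳ (-‿inverseˡ _)))))
      (IdealAt-+ (IdealAt-scale (f []) (ideal (suc d)))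
        (IdealAt-∷ {g = (f *S h) -S scale (f []) h} λ x →
          IdealAt-cong (λ w _ → trans (+-congʳ (trans (*S-∷ f h x w) (+-comm _ _)))
                          (trans (+-assoc _ _ _) (+-vanishʳ (-‿inverseʳ _))))
            (IdealAt-*ˡ ideal d (∂ x f))))

  -- Mirror image with the last letter split off. The constant term of `f` now appears on the right,
  -- and commutativity of the coefficients turns it into a scalar for `scale`.
  IdealAt-*ʳ : ∀ {h} → InCFIdeal h → ∀ d f → IdealAt d (h *S f)
  IdealAt-*ʳ {h} ideal zero    f =
    IdealAt-cong (λ { [] _ → trans (*S-[] h f) (*-comm _ _) ; (_ ∷ _) () }) (IdealAt-scale (f []) (ideal zero))
  IdealAt-*ʳ {h} ideal (suc d) f =
    IdealAt-cong (λ w _ → sym (trans (+-comm _ _) (trans (+-assoc _ _ _) (+-vanishʳ (-‿inverseˡ _)))))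
      (IdealAt-+ (IdealAt-scale (f []) (ideal (suc d)))
        (IdealAt-∷ʳ {g = (h *S f) -S scale (f []) h} λ x →
          IdealAt-cong (λ w _ → trans (+-congʳ (trans (*S-∷ʳ h f w x)
                            (trans (+-congʳ (*-comm _ _)) (+-comm _ _))))
                          (trans (+-assoc _ _ _) (+-vanishʳ (-‿inverseʳ _))))
            (IdealAt-*ʳ ideal d (∂ʳ x f))))

  -- Quotients of the series ring

  record Congruence ℓ′ : Set (c ⊔ ℓ ⊔ lsuc ℓ′) where
    infix 4 _~_
    field
      _~_             : Series m → Series m → Set ℓ′
      ~-isEquivalence : IsEquivalence _~_
      ≐⇒~             : ∀ {f g} → f ≐ g → f ~ g
      +S-resp         : ∀ {f f′ g g′} → f ~ f′ → g ~ g′ → f +S g ~ f′ +S g′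
      -S-resp         : ∀ {f f′} → f ~ f′ → -S f ~ -S f′
      *S-resp         : ∀ {f f′ g g′} → f ~ f′ → g ~ g′ → f *S g ~ f′ *S g′

    -- Series remain the carrier and only the equality changes, so the ring laws are inherited from
    -- coefficientwise equality.
    quotient : Ring c ℓ′
    quotient = record
      { Carrier = Series m
      ; _≈_ = _~_
      ; _+_ = _+S_
      ; _*_ = _*S_
      ; -_ = -S_
      ; 0# = 0S
      ; 1# = 1S
      ; isRing = record
        { +-isAbelianGroup = record
          { isGroup = record
            { isMonoid = record
              { isSemigroup = record
                { isMagma = record { isEquivalence = ~-isEquivalence ; ∙-cong = +S-resp }
                ; assoc = λ _ _ _ → ≐⇒~ λ _ → +-assoc _ _ _ }
              ; identity = (λ _ → ≐⇒~ λ _ → +-identityˡ _) , (λ _ → ≐⇒~ λ _ → +-identityʳ _) }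
            ; inverse = (λ _ → ≐⇒~ λ _ → -‿inverseˡ _) , (λ _ → ≐⇒~ λ _ → -‿inverseʳ _)
            ; ⁻¹-cong = -S-resp }
          ; comm = λ _ _ → ≐⇒~ λ _ → +-comm _ _ }
        ; *-cong = *S-resp
        ; *-assoc = λ f g h → ≐⇒~ (*S-assoc f g h)
        ; *-identity = (λ f → ≐⇒~ (*S-identityˡ f)) , (λ f → ≐⇒~ (*S-identityʳ f))
        ; distrib = (λ f g h → ≐⇒~ (*S-distribˡ f g h)) , (λ f g h → ≐⇒~ (*S-distribʳ f g h))
        }
      }

  pointwise : Congruence ℓ
  pointwise = record
    { _~_ = _≐_
    ; ~-isEquivalence = record
      { refl = λ _ → refl
      ; sym = λ h w → sym (h w)
      ; trans = λ h h′ w → trans (h w) (h′ w) }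
    ; ≐⇒~ = λ h → h
    ; +S-resp = λ h h′ w → +-cong (h w) (h′ w)
    ; -S-resp = λ h w → -‿cong (h w)
    ; *S-resp = *S-cong
    }

  constantTerm : Congruence ℓ
  constantTerm = record
    { _~_ = λ f g → f [] ≈ g []
    ; ~-isEquivalence = record { refl = refl ; sym = sym ; trans = trans }
    ; ≐⇒~ = λ h → h []
    ; +S-resp = +-cong
    ; -S-resp = -‿cong
    ; *S-resp = λ {f} {f′} {g} {g′} h h′ →
        trans (*S-[] f g) (trans (*-cong h h′) (sym (*S-[] f′ g′)))
    }

  cartierFoata : Congruence (c ⊔ ℓ)
  cartierFoata = record
    { _~_ = _≈CF_
    ; ~-isEquivalence = record
      { refl = ≐⇒CF λ _ → refl
      ; sym = λ h d → IdealAt-cong (λ w _ → sym (trans (-1*x≈-x _) (⁻¹-anti-homo‿- _ _)))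
                        (IdealAt-scale (- 1#) (h d))
      ; trans = λ h h′ d → IdealAt-cong (λ w _ → sym (trans (+-assoc _ _ _)
                    (+-congˡ (trans (sym (+-assoc _ _ _)) (+-vanishˡ (-‿inverseˡ _))))))
                  (IdealAt-+ (h d) (h′ d))
      }
    ; ≐⇒~ = ≐⇒CF
    ; +S-resp = λ h h′ d → IdealAt-cong
        (λ w _ → trans (+-congˡ (sym (-‿+-comm _ _))) (+-interchange _ _ _ _))
        (IdealAt-+ (h d) (h′ d))
    ; -S-resp = λ h d → IdealAt-cong
        (λ w _ → trans (-‿+-comm _ _) (sym (-1*x≈-x _))) (IdealAt-scale (- 1#) (h d))
    -- f g - f′ g′ = (f - f′) g + f′ (g - g′), so closure of the ideal on both sides is used.
    ; *S-resp = λ {f} {f′} {g} {g′} h h′ d → IdealAt-cong (λ w _ → split f f′ g g′ w)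
        (IdealAt-+ (IdealAt-*ʳ {f -S f′} h d g) (IdealAt-*ˡ {g -S g′} h′ d f′))
    }
    where
    ≐⇒CF : ∀ {f g} → f ≐ g → f ≈CF g
    ≐⇒CF h d = IdealAt-cong (λ w _ → trans (+-congʳ (h w)) (-‿inverseʳ _)) IdealAt-0
    module PP = Algebra.Properties.Ring (Congruence.quotient pointwise)
    split : ∀ f f′ g g′ → (f *S g) -S (f′ *S g′) ≐ ((f -S f′) *S g) +S (f′ *S (g -S g′))
    split f f′ g g′ w = sym (begin
      ((f -S f′) *S g) w + (f′ *S (g -S g′)) w
        ≈⟨ +-cong (PP.[y-z]x≈yx-zx g f f′ w) (PP.x[y-z]≈xy-xz f′ g g′ w) ⟩
      ((f *S g) w - (f′ *S g) w) + ((f′ *S g) w - (f′ *S g′) w)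
        ≈⟨ trans (+-assoc _ _ _) (+-congˡ (trans (sym (+-assoc _ _ _)) (+-vanishˡ (-‿inverseˡ _)))) ⟩
      (f *S g) w - (f′ *S g′) w ∎)

  -- Variables, linear systems and inverses

  var-commute : ∀ {i j} → i ≢ j → ∀ k l → (var i k *S var j l) ≈CF (var j l *S var i k)
  var-commute {i} {j} i≢j k l d =
    record { coef = 1# ; left = [] ; x = i , k ; y = j , l ; rows≢ = i≢j ; right = [] } ∷ [] ,
    λ w _ → trans (+-cong (δ-*S-δ _ _ w) (-‿cong (δ-*S-δ _ _ w)))
      (sym (trans (+-identityʳ _) (*-identityˡ _)))

  var-*S-∷ : ∀ i j (f : Series m) x w → (var i j *S f) (x ∷ w) ≈ δ ((i , j) ∷ []) (x ∷ []) * f w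
  var-*S-∷ i j f x w = begin
    (var i j *S f) (x ∷ w)                      ≈⟨ *S-∷ (var i j) f x w ⟩
    0# * f (x ∷ w) + (∂ x (var i j) *S f) w     ≈⟨ +-vanishˡ (zeroˡ _) ⟩
    (∂ x (var i j) *S f) w                      ≈⟨ *S-cong {g = f} derivative (λ _ → refl) w ⟩
    (scale r 1S *S f) w                         ≈⟨ scale-*S r 1S f w ⟩
    r * (1S *S f) w                             ≈⟨ *-congˡ (*S-identityˡ f w) ⟩
    r * f w                                     ∎
    where
    r : Carrier
    r = δ ((i , j) ∷ []) (x ∷ [])
    derivative : ∂ x (var i j) ≐ scale r 1S
    derivative []      = sym (*-identityʳ _)
    derivative (y ∷ v) = trans (reflexive (δ-≢ λ ())) (sym (zeroʳ r))

  -- Solves X_i = q_i + Σ_l a_{ρ(i),κ(l)} X_l by recursion on words.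
  module LinearSystem {n} (ρ κ : Fin n → Fin m) (q : Fin n → Series m) where
    solution : Fin n → Series m
    solution i []      = q i []
    solution i (x ∷ w) = q i (x ∷ w) + ∑ λ l → δ ((ρ i , κ l) ∷ []) (x ∷ []) * solution l w

    solution-fixed : ∀ i w → solution i w ≈ q i w + ∑ λ l → (var (ρ i) (κ l) *S solution l) w
    solution-fixed i []      = sym (+-vanishʳ (Alternating.∑-zero ring λ l →
      trans (*S-[] (var (ρ i) (κ l)) (solution l)) (zeroˡ _)))
    solution-fixed i (x ∷ w) = +-congˡ (∑-cong λ l → sym (var-*S-∷ (ρ i) (κ l) (solution l) x w))

  module Inverse (f : Series m) (f[] : f [] ≈ 1#) where
    g : Series m
    g = 1S -S f

    g[] : g [] ≈ 0#
    g[] = trans (+-congˡ (-‿cong f[])) (-‿inverseʳ 1#)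

    *S-cong-≤ˡ : ∀ {h h′ : Series m} d w → length w ≤ d → (∀ v → length v ≤ d → h v ≈ h′ v) →
      ∀ e → (h *S e) w ≈ (h′ *S e) w
    *S-cong-≤ˡ {h} {h′} d       []      l       eq e = +-congʳ (*-congʳ (eq [] z≤n))
    *S-cong-≤ˡ {h} {h′} (suc d) (x ∷ w) (s≤s l) eq e = begin
      (h *S e) (x ∷ w)                    ≈⟨ *S-∷ h e x w ⟩
      h [] * e (x ∷ w) + (∂ x h *S e) w   ≈⟨ +-cong (*-congʳ (eq [] z≤n))
                                               (*S-cong-≤ˡ d w l (λ v l′ → eq (x ∷ v) (s≤s l′)) e) ⟩
      h′ [] * e (x ∷ w) + (∂ x h′ *S e) w ≈⟨ sym (*S-∷ h′ e x w) ⟩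
      (h′ *S e) (x ∷ w)                   ∎

    *S-cong-≤ʳ : ∀ {h h′ : Series m} d w → length w ≤ d → (∀ v → length v ≤ d → h v ≈ h′ v) →
      ∀ e → (e *S h) w ≈ (e *S h′) w
    *S-cong-≤ʳ {h} {h′} d []      l eq e = +-congʳ (*-congˡ (eq [] z≤n))
    *S-cong-≤ʳ {h} {h′} d (x ∷ w) l eq e = begin
      (e *S h) (x ∷ w)                    ≈⟨ *S-∷ e h x w ⟩
      e [] * h (x ∷ w) + (∂ x e *S h) w   ≈⟨ +-cong (*-congˡ (eq (x ∷ w) l))
                                               (*S-cong-≤ʳ d w (ℕₚ.≤-trans (ℕₚ.n≤1+n _) l) eq (∂ x e)) ⟩
      e [] * h′ (x ∷ w) + (∂ x e *S h′) w ≈⟨ sym (*S-∷ e h′ x w) ⟩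
      (e *S h′) (x ∷ w)                   ∎

    -- As `g` has no constant term, the coefficient of g h at `w` reads `h` only on words strictly
    -- shorter than `w`. This gain of one degree gives `geometric-stable` and `powS-vanish`.
    g*-cong : ∀ {h h′ : Series m} d w → length w ≤ d → (∀ v → length v ℕ.< d → h v ≈ h′ v) → (g *S h) w ≈ (g *S h′) w
    g*-cong {h} {h′} d       []      l       eq =
      trans (trans (*S-[] g h) (*-vanishˡ g[])) (sym (trans (*S-[] g h′) (*-vanishˡ g[])))
    g*-cong {h} {h′} (suc d) (x ∷ w) (s≤s l) eq = begin
      (g *S h) (x ∷ w)                    ≈⟨ *S-∷ g h x w ⟩
      g [] * h (x ∷ w) + (∂ x g *S h) w   ≈⟨ +-cong (trans (*-vanishˡ g[]) (sym (*-vanishˡ g[])))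
                                               (*S-cong-≤ʳ d w l (λ v l′ → eq v (s≤s l′)) (∂ x g)) ⟩
      g [] * h′ (x ∷ w) + (∂ x g *S h′) w ≈⟨ sym (*S-∷ g h′ x w) ⟩
      (g *S h′) (x ∷ w)                   ∎

    -- Horner form of 1 + g + ⋯ + g^(M-1), which turns stability and telescoping into inductions on
    -- the number of terms.
    geometric : ℕ → Series m
    geometric zero    = 0S
    geometric (suc M) = 1S +S (g *S geometric M)

    geometric-stable : ∀ {M M′} → M ≤ M′ → ∀ w → length w ℕ.< M → geometric M w ≈ geometric M′ w
    geometric-stable (s≤s {M} le) w (s≤s l) = +-congˡ (g*-cong M w l (geometric-stable le))

    powS-vanish : ∀ M w → length w ℕ.< M → powS g M w ≈ 0#
    powS-vanish (suc M) w (s≤s l) = trans (g*-cong M w l (powS-vanish M))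
      (Ring.zeroʳ (Congruence.quotient pointwise) g w)

    geometric-*S : ∀ M → geometric M *S f ≐ 1S -S powS g M
    geometric-*S zero    w = trans (*S-zeroˡ f (λ _ → refl) w) (sym (-‿inverseʳ _))
    geometric-*S (suc M) w = begin
      ((1S +S (g *S geometric M)) *S f) w
        ≈⟨ *S-distribʳ f 1S (g *S geometric M) w ⟩
      (1S *S f) w + ((g *S geometric M) *S f) w
        ≈⟨ +-cong (*S-identityˡ f w) (trans (*S-assoc g (geometric M) f w)
             (*S-cong {g} (λ _ → refl) (geometric-*S M) w)) ⟩
      f w + (g *S (1S -S powS g M)) w
        ≈⟨ +-congˡ (trans (PP.x[y-z]≈xy-xz g 1S (powS g M) w)
             (+-congʳ (*S-identityʳ g w))) ⟩
      f w + ((1S w - f w) - powS g (suc M) w)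
        ≈⟨ trans (sym (+-assoc _ _ _)) (+-congʳ
             (trans (+-comm _ _) (trans (+-assoc _ _ _) (+-vanishʳ (-‿inverseˡ _))))) ⟩
      1S w - powS g (suc M) w ∎
      where module PP = Algebra.Properties.Ring (Congruence.quotient pointwise)

    *S-ΣR : ∀ e (F : ℕ → Series m) ks w →
      (e *S (λ v → ΣR (map (λ k → F k v) ks))) w ≈ ΣR (map (λ k → (e *S F k) w) ks)
    *S-ΣR e F []       w = Ring.zeroʳ (Congruence.quotient pointwise) e w
    *S-ΣR e F (k ∷ ks) w =
      trans (*S-distribˡ e (F k) (λ v → ΣR (map (λ k → F k v) ks)) w) (+-congˡ (*S-ΣR e F ks w))

    ΣR-powS : ∀ M w → ΣR (map (λ k → powS g k w) (upTo M)) ≈ geometric M w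
    ΣR-powS zero    w = refl
    ΣR-powS (suc M) w = +-congˡ (begin
      ΣR (map (λ k → powS g k w) (List.applyUpTo suc M))
        ≡⟨ ≡.cong (λ ks → ΣR (map (λ k → powS g k w) ks)) (≡.sym (Listₚ.map-upTo suc M)) ⟩
      ΣR (map (λ k → powS g k w) (map suc (upTo M)))
        ≡⟨ ≡.cong ΣR (≡.sym (Listₚ.map-∘ (upTo M))) ⟩
      ΣR (map (λ k → (g *S powS g k) w) (upTo M))
        ≈⟨ sym (*S-ΣR g (powS g) (upTo M) w) ⟩
      (g *S (λ v → ΣR (map (λ k → powS g k v) (upTo M)))) w
        ≈⟨ *S-cong {g} (λ _ → refl) (ΣR-powS M) w ⟩
      (g *S geometric M) w ∎)

    invS-*S : invS f *S f ≐ 1S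
    invS-*S w = begin
      (invS f *S f) w
        -- `invS` truncates at a point depending on the word. On words no longer than `w` every such
        -- truncation agrees with the single one at `suc (length w)`, to which telescoping applies.
        ≈⟨ *S-cong-≤ˡ (length w) w ℕₚ.≤-refl (λ v l → trans (ΣR-powS (suc (length v)) v)
             (geometric-stable (s≤s l) v ℕₚ.≤-refl)) f ⟩
      (geometric (suc (length w)) *S f) w
        ≈⟨ geometric-*S (suc (length w)) w ⟩
      1S w - powS g (suc (length w)) w
        ≈⟨ trans (+-congˡ (-‿cong (powS-vanish (suc (length w)) w ℕₚ.≤-refl))) (+-vanishʳ -0#≈0#) ⟩
      1S w ∎

-- The Leibniz sum as a contraction

module Leibniz {c ℓ} (K : CommutativeRing c ℓ) (m : ℕ) {ℓ′}
  (cong : SeriesAlgebra.Congruence K m ℓ′) where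
  open SeriesAlgebra K m using (module Congruence)
  open Congruence cong using (≐⇒~; quotient)
  open WithRing K
  open Alternating quotient
  open Ring quotient hiding (zero)
  open import Algebra.Properties.Ring quotient
  open import Relation.Binary.Reasoning.Setoid setoid

  private
    module R = CommutativeRing K
    module RP = Algebra.Properties.Ring R.ring

  if-0S : ∀ (b : Bool) {f g} → f ≈ g → (if b then f else 0S) ≈ (if b then g else 0S)
  if-0S true  h = h
  if-0S false h = refl

  ΣS-map-cong : ∀ {a} {A : Set a} {f g : A → Series m} → (∀ x → f x ≈ g x) → ∀ xs →
    ΣS (map f xs) ≈ ΣS (map g xs)
  ΣS-map-cong h []       = refl
  ΣS-map-cong h (x ∷ xs) = +-cong (h x) (ΣS-map-cong h xs)

  ΣS-filterᵇ : ∀ {a} {A : Set a} (p : A → Bool) (f : A → Series m) xs →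
    ΣS (map f (filterᵇ p xs)) ≈ ΣS (map (λ x → if p x then f x else 0S) xs)
  ΣS-filterᵇ p f []       = refl
  ΣS-filterᵇ p f (x ∷ xs) with p x
  ... | true  = +-congˡ (ΣS-filterᵇ p f xs)
  ... | false = trans (ΣS-filterᵇ p f xs) (sym (+-identityˡ _))

  ΣS-++ : ∀ (xs ys : List (Series m)) → ΣS (xs ++ ys) ≈ ΣS xs + ΣS ys
  ΣS-++ []       ys = sym (+-identityˡ _)
  ΣS-++ (x ∷ xs) ys = trans (+-congˡ (ΣS-++ xs ys)) (sym (+-assoc _ _ _))

  ΣS-concatMap : ∀ {a b} {A : Set a} {B : Set b} (f : B → Series m) (g : A → List B) xs →
    ΣS (map f (concatMap g xs)) ≈ ΣS (map (λ x → ΣS (map f (g x))) xs)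
  ΣS-concatMap f g []       = refl
  ΣS-concatMap f g (x ∷ xs) = begin
    ΣS (map f (g x ++ concatMap g xs))
      ≡⟨ ≡.cong ΣS (Listₚ.map-++ f (g x) (concatMap g xs)) ⟩
    ΣS (map f (g x) ++ map f (concatMap g xs))
      ≈⟨ ΣS-++ (map f (g x)) _ ⟩
    ΣS (map f (g x)) + ΣS (map f (concatMap g xs))
      ≈⟨ +-congˡ (ΣS-concatMap f g xs) ⟩
    ΣS (map f (g x)) + ΣS (map (λ x → ΣS (map f (g x))) xs) ∎

  ΣS-tabulate : ∀ {N} (f : Fin N → Series m) → ΣS (tabulate f) ≈ ∑ f
  ΣS-tabulate {zero}  f = sym (∑-empty f)
  ΣS-tabulate {suc N} f = trans (+-congˡ (ΣS-tabulate (f ∘ suc))) (sym (∑-suc f))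

  *-distribˡ-ΣS : ∀ {a} {A : Set a} e (f : A → Series m) xs →
    e * ΣS (map f xs) ≈ ΣS (map (λ x → e * f x) xs)
  *-distribˡ-ΣS e f []       = zeroʳ e
  *-distribˡ-ΣS e f (x ∷ xs) = trans (distribˡ _ _ _) (+-congˡ (*-distribˡ-ΣS e f xs))

  product : ∀ {N k} → (Fin k → Column N) → Vec (Fin N) k → Series m
  product cs v = ΠS (tabulate λ j → cs j (Vec.lookup v j))

  ΣS-vecs : ∀ {N} k (cs : Fin k → Column N) (ψ : Form N) u →
    ΣS (map (λ v → product cs v * ψ (u ++ toList v)) (vecs {m} N k)) ≈ contractAll (tabulate cs) ψ u
  ΣS-vecs zero    cs ψ u = trans (+-identityʳ _) (trans (*-identityˡ _)
    (reflexive (≡.cong ψ (Listₚ.++-identityʳ u))))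
  ΣS-vecs {N} (suc k) cs ψ u = begin
    ΣS (map F (concatMap (λ i → map (i ∷_) (vecs {m} N k)) (allFin N)))
      ≈⟨ ΣS-concatMap F _ (allFin N) ⟩
    ΣS (map (λ i → ΣS (map F (map (i ∷_) (vecs {m} N k)))) (allFin N))
      ≡⟨ ≡.cong ΣS (Listₚ.map-tabulate {n = N} (λ i → i) _) ⟩
    ΣS (tabulate (λ i → ΣS (map F (map (i ∷_) (vecs {m} N k)))))
      ≈⟨ ΣS-tabulate (λ i → ΣS (map F (map (i ∷_) (vecs {m} N k)))) ⟩
    ∑ (λ i → ΣS (map F (map (i ∷_) (vecs {m} N k))))
      ≈⟨ ∑-cong slice ⟩
    ∑ (λ i → cs zero i * contractAll (tabulate (cs ∘ suc)) ψ (u ∷ʳ i)) ∎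
    where
    F : Vec (Fin N) (suc k) → Series m
    F v = product cs v * ψ (u ++ toList v)
    slice : ∀ i → ΣS (map F (map (i ∷_) (vecs {m} N k))) ≈
                  cs zero i * contractAll (tabulate (cs ∘ suc)) ψ (u ∷ʳ i)
    slice i = begin
      ΣS (map F (map (i ∷_) (vecs {m} N k)))
        ≡⟨ ≡.cong ΣS (Listₚ.map-∘ (vecs {m} N k)) ⟨
      ΣS (map (λ v → F (i ∷ v)) (vecs {m} N k))
        ≈⟨ ΣS-map-cong (λ v → trans (*-assoc _ _ _) (*-congˡ (*-congˡ (reflexive
             (≡.cong ψ (≡.sym (Listₚ.++-assoc u (i ∷ []) (toList v)))))))) (vecs {m} N k) ⟩
      ΣS (map (λ v → cs zero i * (product (cs ∘ suc) v * ψ ((u ∷ʳ i) ++ toList v))) (vecs {m} N k))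
        ≈⟨ sym (*-distribˡ-ΣS (cs zero i) (λ v → product (cs ∘ suc) v * ψ ((u ∷ʳ i) ++ toList v)) (vecs {m} N k)) ⟩
      cs zero i * ΣS (map (λ v → product (cs ∘ suc) v * ψ ((u ∷ʳ i) ++ toList v)) (vecs {m} N k))
        ≈⟨ *-congˡ (ΣS-vecs k (cs ∘ suc) ψ (u ∷ʳ i)) ⟩
      cs zero i * contractAll (tabulate (cs ∘ suc)) ψ (u ∷ʳ i) ∎

  -- The sign as a series: `ε` takes values in the series ring, `sign` in the coefficient ring.
  signS : ℕ → Series m
  signS zero    = 1S
  signS (suc k) = -S signS k

  signS-+ : ∀ p q → signS p * signS q ≈ signS (p +ℕ q)
  signS-+ zero    q = *-identityˡ _
  signS-+ (suc p) q = trans (sym (-‿distribˡ-* _ _)) (-‿cong (signS-+ p q))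

  scale-sign : ∀ k f → scale (sign {m} k) f ≈ f * signS k
  scale-sign zero    f = trans (≐⇒~ λ w → R.*-identityˡ _) (sym (*-identityʳ f))
  scale-sign (suc k) f = trans (≐⇒~ λ w → R.sym (RP.-‿distribˡ-* (sign {m} k) (f w)))
    (trans (-‿cong (scale-sign k f)) (-‿distribʳ-* f (signS k)))

  -- The shape of every value of `ε`: zero at a repetition, otherwise a sign. Such values multiply
  -- by conjunction and addition, just as `distinct` and `inversions` are computed.
  signIf : Bool → ℕ → Series m
  signIf b k = if b then signS k else 0S

  signIf-* : ∀ a p b q → signIf a p * signIf b q ≈ signIf (a ∧ b) (p +ℕ q)
  signIf-* true  p true  q = signS-+ p q
  signIf-* true  p false q = zeroʳ _
  signIf-* false p b     q = zeroˡ _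

  χ-sign : ∀ {N} (x y : Fin N) →
    χ x y ≈ signIf (not ⌊ x Finₚ.≟ y ⌋) (if ⌊ y Fin.<? x ⌋ then 1 else 0)
  χ-sign x y with x Finₚ.≟ y | y Fin.<? x
  ... | yes ≡.refl | _       = χ-diagonal x
  ... | no _       | yes y<x =
    trans (+-inverseˡ-unique _ _ (χ-antisym x y)) (-‿cong (χ-< y<x))
  ... | no x≢y     | no y≮x  = χ-< (Finₚ.≤∧≢⇒< (ℕₚ.≮⇒≥ y≮x) x≢y)

  χ*-sign : ∀ {N k} (x : Fin N) (v : Vec (Fin N) k) →
    χ* x (toList v) ≈ signIf (notIn {m} x v) (smaller {m} x v)
  χ*-sign x []      = refl
  χ*-sign x (y ∷ v) = trans (*-cong (χ-sign x y) (χ*-sign x v))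
    (signIf-* (not ⌊ x Finₚ.≟ y ⌋) (if ⌊ y Fin.<? x ⌋ then 1 else 0) (notIn {m} x v) (smaller {m} x v))

  ε-sign : ∀ {N k} (v : Vec (Fin N) k) → ε (toList v) ≈ signIf (distinct {m} v) (inversions {m} v)
  ε-sign []      = refl
  ε-sign (x ∷ v) = trans (*-cong (χ*-sign x v) (ε-sign v))
    (signIf-* (notIn {m} x v) (smaller {m} x v) (distinct {m} v) (inversions {m} v))

  -- As `ε` vanishes on repetitions, the sum over permutations extends to all vectors, and that sum
  -- factors column by column. It holds for every congruence because it is applied both to constant
  -- terms and to the Cartier-Foata quotient.
  det≈Det : ∀ N (B : Matrix N) → det N B ≈ Det B
  det≈Det N B = begin
    ΣS (map term (filterᵇ (distinct {m}) (vecs {m} N N)))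
      ≈⟨ ΣS-filterᵇ (distinct {m}) term (vecs {m} N N) ⟩
    ΣS (map (λ v → if distinct {m} v then term v else 0S) (vecs {m} N N))
      ≈⟨ ΣS-map-cong signed (vecs {m} N N) ⟩
    ΣS (map (λ v → product (column B) v * ε (toList v)) (vecs {m} N N))
      ≈⟨ ΣS-vecs N (column B) ε [] ⟩
    Det B ∎
    where
    term : Vec (Fin N) N → Series m
    term v = scale (sign {m} (inversions {m} v)) (ΠS (map (λ j → B (Vec.lookup v j) j) (allFin N)))
    absorb : ∀ b f k → (if b then f * signS k else 0S) ≈ f * signIf b k
    absorb true  f k = refl
    absorb false f k = sym (zeroʳ f)
    signed : ∀ v → (if distinct {m} v then term v else 0S) ≈ product (column B) v * ε (toList v)
    signed v = begin
      (if distinct {m} v then term v else 0S)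
        ≈⟨ if-0S (distinct {m} v) (scale-sign (inversions {m} v) _) ⟩
      (if distinct {m} v then ΠS (map (λ j → B (Vec.lookup v j) j) (allFin N)) * signS (inversions {m} v) else 0S)
        ≈⟨ absorb (distinct {m} v) _ (inversions {m} v) ⟩
      ΠS (map (λ j → B (Vec.lookup v j) j) (allFin N)) * signIf (distinct {m} v) (inversions {m} v)
        ≈⟨ *-cong (reflexive (≡.cong ΠS (Listₚ.map-tabulate (λ j → j) (λ j → B (Vec.lookup v j) j))))
             (sym (ε-sign v)) ⟩
      product (column B) v * ε (toList v) ∎

  -- The linear system is solved with sums of coefficients, the elimination uses sums in the
  -- quotient ring; both are opaque, so this is the bridge.
  ∑-pointwise : ∀ {N} (F : Fin N → Series m) →
    ∑ F ≈ λ w → Alternating.∑ R.ring (λ i → F i w)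
  ∑-pointwise {zero}  F = trans (∑-empty F) (≐⇒~ λ w → R.sym (Alternating.∑-empty R.ring _))
  ∑-pointwise {suc N} F = trans (∑-suc F) (trans (+-congˡ (∑-pointwise (F ∘ suc)))
    (≐⇒~ λ w → R.sym (Alternating.∑-suc R.ring _)))

-- Application to I - A and its bordered blocks

module Theorem54 {c ℓ} (K : CommutativeRing c ℓ) (n k : ℕ) where
  open WithRing K
  open Thm54 n k
  open SeriesAlgebra K (n +ℕ k)
  open Leibniz K (n +ℕ k) cartierFoata
  open Congruence cartierFoata using (≐⇒~; quotient)
  open Alternating quotient
  open Ring quotient hiding (zero)
  open import Algebra.Properties.Ring quotient
  open import Relation.Binary.Reasoning.Setoid setoid

  private
    module R = CommutativeRing K
    module RP = Algebra.Properties.Ring R.ring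

    m : ℕ
    m = n +ℕ k

    left : Fin n → Fin m
    left = _↑ˡ k

    right : Fin k → Fin m
    right = n ↑ʳ_

  left≢right : ∀ {a b} {i : Fin a} {j : Fin b} → i ↑ˡ b ≢ a ↑ʳ j
  left≢right {a} {b} {i} {j} eq
    with ≡.trans (≡.sym (Finₚ.splitAt-↑ˡ a i b)) (≡.trans (≡.cong (splitAt a) eq) (Finₚ.splitAt-↑ʳ a b j))
  ... | ()

  idS-diagonal : ∀ {N} (i : Fin N) → idS i i ≡ 1S {m}
  idS-diagonal i with i Finₚ.≟ i
  ... | yes _  = ≡.refl
  ... | no i≢i = contradiction ≡.refl i≢i

  idS-≢ : ∀ {N} {i j : Fin N} → i ≢ j → idS i j ≡ 0S {m}
  idS-≢ {i = i} {j} i≢j with i Finₚ.≟ j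
  ... | yes i≡j = contradiction i≡j i≢j
  ... | no _    = ≡.refl

  idS-injective : ∀ {M N} (e : Fin M → Fin N) → (∀ i j → e i ≡ e j → i ≡ j) →
    ∀ i j → idS (e i) (e j) ≡ idS {m} i j
  idS-injective e inj i j with i Finₚ.≟ j
  ... | yes i≡j = ≡.trans (≡.cong (idS (e i)) (≡.cong e (≡.sym i≡j))) (idS-diagonal (e i))
  ... | no i≢j  = idS-≢ (i≢j ∘ inj i j)

  idS-Central : ∀ {N} (i j : Fin N) → Central (idS i j)
  idS-Central i j with i Finₚ.≟ j
  ... | yes _ = 1-Central
  ... | no _  = 0-Central

  -- Common shape of the entries of I - A and of the bordered blocks: a central part, 0 or 1, minus
  -- one variable of row `p`. Such entries commute across rows because the variables do, whatever
  -- their columns.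
  AffineInRow : Fin m → Series m → Set (c ⊔ ℓ)
  AffineInRow p f = ∃ λ z → ∃ λ l → Central z × f ≈ z - A p l

  commute-minus : ∀ {x y z} → x * y ≈ y * x → x * z ≈ z * x → x * (y - z) ≈ (y - z) * x
  commute-minus {x} {y} {z} hy hz = trans (x[y-z]≈xy-xz x y z)
    (trans (+-cong hy (-‿cong hz)) (sym ([y-z]x≈yx-zx x y z)))

  AffineInRow-commute : ∀ {p q f g} → p ≢ q → AffineInRow p f → AffineInRow q g → f * g ≈ g * f
  AffineInRow-commute {p} {q} {f} {g} p≢q (z , l , hz , ef) (z′ , l′ , hz′ , eg) = begin
    f * g                        ≈⟨ *-cong ef eg ⟩
    (z - A p l) * (z′ - A q l′)  ≈⟨ commute-minus (sym (hz′ _))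
                                      (sym (commute-minus (sym (hz _)) (sym (var-commute p≢q l l′)))) ⟩
    (z′ - A q l′) * (z - A p l)  ≈⟨ sym (*-cong eg ef) ⟩
    g * f                        ∎

  I-A-rows : RowsCommute I-A
  I-A-rows {x} {y} x≢y l l′ = AffineInRow-commute x≢y
    (idS x l , l , idS-Central x l , refl) (idS y l′ , l′ , idS-Central y l′ , refl)

  -- Column j is the solution of X = -a_{*j} + A₀ X, formally (I - A₀)⁻¹ applied to -a_{*j}.
  X : Fin n → Fin k → Series m
  X i j = LinearSystem.solution left left (λ i → -S A (left i) (right j)) i

  ∑-X : ∀ i j → ∑ (λ l → (idS i l - A (left i) (left l)) * X l j) ≈ - A (left i) (right j)
  ∑-X i j = begin
    ∑ (λ l → (idS i l - A (left i) (left l)) * X l j)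
      ≈⟨ ∑-cong (λ l → distribʳ _ _ _) ⟩
    ∑ (λ l → idS i l * X l j + - A (left i) (left l) * X l j)
      ≈⟨ ∑-+ (λ l → idS i l * X l j) (λ l → - A (left i) (left l) * X l j) ⟩
    ∑ (λ l → idS i l * X l j) + ∑ (λ l → - A (left i) (left l) * X l j)
      ≈⟨ +-congʳ (∑-single (λ l → idS i l * X l j) i
           (λ l l≢i → *-vanishˡ (reflexive (idS-≢ (l≢i ∘ ≡.sym))))) ⟩
    idS i i * X i j + ∑ (λ l → - A (left i) (left l) * X l j)
      ≈⟨ +-congʳ (trans (*-congʳ (reflexive (idS-diagonal i))) (*-identityˡ _)) ⟩
    X i j + ∑ (λ l → - A (left i) (left l) * X l j)
      ≈⟨ +-congʳ (trans (≐⇒~ (LinearSystem.solution-fixed left left (λ i → -S A (left i) (right j)) i))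
           (+-congˡ (sym (∑-pointwise (λ l → A (left i) (left l) * X l j))))) ⟩
    (- A (left i) (right j) + ∑ (λ l → A (left i) (left l) * X l j)) +
      ∑ (λ l → - A (left i) (left l) * X l j)
      ≈⟨ trans (+-assoc _ _ _) (+-vanishʳ (trans (sym (∑-+ (λ l → A (left i) (left l) * X l j) _))
           (∑-zero λ l → trans (sym (distribʳ _ _ _)) (*-vanishˡ (-‿inverseʳ _))))) ⟩
    - A (left i) (right j) ∎

  I-A-left : ∀ i j → I-A (left i) (left j) ≡ idS i j -S A (left i) (left j)
  I-A-left i j = ≡.cong (_-S A (left i) (left j)) (idS-injective left (Finₚ.↑ˡ-injective k) i j)

  I-A-left-right : ∀ i j → I-A (left i) (right j) ≈ - A (left i) (right j)
  I-A-left-right i j = trans (+-congʳ (reflexive (idS-≢ {i = left i} {right j} left≢right))) (+-identityˡ _)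

  I-A-solves : ∀ i j → I-A (left i) (right j) ≈ ∑ λ l → I-A (left i) (left l) * X l j
  I-A-solves i j = trans (I-A-left-right i j)
    (sym (trans (∑-cong λ l → *-congʳ (reflexive (I-A-left i l))) (∑-X i j)))

  module Whole = Schur n k I-A I-A-rows X I-A-solves

  module Bordered (i j : Fin k) where

    -- The row of A that supplies the variables in row r of the block. Its injectivity carries the
    -- Cartier-Foata relations over to the block.
    row : Fin (n +ℕ 1) → Fin m
    row r with splitAt n r
    ... | inj₁ r′ = left r′
    ... | inj₂ _  = right i

    row-injective : ∀ {r s} → row r ≡ row s → r ≡ s
    row-injective {r} {s} eq with splitAt n r in er | splitAt n s in es
    ... | inj₁ r′   | inj₁ s′   = ≡.trans (≡.sym (Finₚ.splitAt⁻¹-↑ˡ er))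
          (≡.trans (≡.cong (_↑ˡ 1) (Finₚ.↑ˡ-injective k r′ s′ eq)) (Finₚ.splitAt⁻¹-↑ˡ es))
    ... | inj₁ _    | inj₂ _    = contradiction eq left≢right
    ... | inj₂ _    | inj₁ _    = contradiction (≡.sym eq) left≢right
    ... | inj₂ zero | inj₂ zero = ≡.trans (≡.sym (Finₚ.splitAt⁻¹-↑ʳ er)) (Finₚ.splitAt⁻¹-↑ʳ es)

    block-AffineInRow : ∀ r s → AffineInRow (row r) (block i j r s)
    block-AffineInRow r s with splitAt n r | splitAt n s
    ... | inj₁ r′ | inj₁ s′ = idS r′ s′ , left s′ , idS-Central r′ s′ , refl
    ... | inj₁ _  | inj₂ _  = 0S , right j , 0-Central , sym (+-identityˡ _)
    ... | inj₂ _  | inj₁ s′ = 0S , left s′ , 0-Central , sym (+-identityˡ _)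
    ... | inj₂ _  | inj₂ _  = 0S , right j , 0-Central , sym (+-identityˡ _)

    block-rows : RowsCommute (block i j)
    block-rows {x} {y} x≢y l l′ = AffineInRow-commute (x≢y ∘ row-injective)
      (block-AffineInRow x l) (block-AffineInRow y l′)

    block-left-left : ∀ r s → block i j (r ↑ˡ 1) (s ↑ˡ 1) ≡ I-A₀ r s
    block-left-left r s rewrite Finₚ.splitAt-↑ˡ n r 1 | Finₚ.splitAt-↑ˡ n s 1 = ≡.refl

    block-left-right : ∀ r s → block i j (r ↑ˡ 1) (n ↑ʳ s) ≡ -S A (left r) (right j)
    block-left-right r s rewrite Finₚ.splitAt-↑ˡ n r 1 | Finₚ.splitAt-↑ʳ n 1 s = ≡.refl

    block-right-left : ∀ r s → block i j (n ↑ʳ r) (s ↑ˡ 1) ≡ -S A (right i) (left s)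
    block-right-left r s rewrite Finₚ.splitAt-↑ʳ n 1 r | Finₚ.splitAt-↑ˡ n s 1 = ≡.refl

    block-right-right : ∀ r s → block i j (n ↑ʳ r) (n ↑ʳ s) ≡ -S A (right i) (right j)
    block-right-right r s rewrite Finₚ.splitAt-↑ʳ n 1 r | Finₚ.splitAt-↑ʳ n 1 s = ≡.refl

    Xⱼ : Fin n → Fin 1 → Series m
    Xⱼ l _ = X l j

    block-solves : ∀ r s → block i j (r ↑ˡ 1) (n ↑ʳ s) ≈ ∑ λ l → block i j (r ↑ˡ 1) (l ↑ˡ 1) * Xⱼ l s
    block-solves r s = trans (reflexive (block-left-right r s))
      (sym (trans (∑-cong λ l → *-congʳ (reflexive (block-left-left r l))) (∑-X r j)))

    module S = Schur n 1 (block i j) block-rows Xⱼ block-solves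

    -- Schur factorization with a 1×1 complement. The lower right entry of the block is -a_ij
    -- without δ_ij, so the second factor is the (i, j) entry of the Schur complement of I - A minus
    -- δ_ij.
    det-block : det (n +ℕ 1) (block i j) ≈
      det n I-A₀ * (- A (right i) (right j) - ∑ λ l → - A (right i) (left l) * X l j)
    det-block = begin
      det (n +ℕ 1) (block i j)       ≈⟨ det≈Det (n +ℕ 1) (block i j) ⟩
      Det (block i j)                ≈⟨ S.Det-factor ⟩
      Det S.corner * Det S.complement
        ≈⟨ *-cong (trans (Det-cong λ r s → reflexive (block-left-left r s)) (sym (det≈Det n I-A₀)))
             (Det-1×1 S.complement) ⟩
      det n I-A₀ * S.complement zero zero
        ≈⟨ *-congˡ (+-cong (reflexive (block-right-right zero zero))
             (-‿cong (∑-cong λ l → *-congʳ (reflexive (block-right-left zero l))))) ⟩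
      det n I-A₀ * (- A (right i) (right j) - ∑ λ l → - A (right i) (left l) * X l j) ∎

  -- Modulo series without constant term, I - A₀ is the identity matrix, so the determinant is
  -- evaluated in that quotient.
  det-I-A₀-constant : det n I-A₀ [] R.≈ R.1#
  det-I-A₀-constant = R.trans (Leibniz.det≈Det K m constantTerm n I-A₀)
    (Alternating.Det-identity (Congruence.quotient constantTerm) {n} {I-A₀}
      (λ i → R.trans (R.+-cong (R.reflexive (≡.cong (λ f → f []) (idS-diagonal i))) RP.-0#≈0#) (R.+-identityʳ _))
      (λ i≢j → R.trans (R.+-cong (R.reflexive (≡.cong (λ f → f []) (idS-≢ i≢j))) RP.-0#≈0#) (R.+-identityʳ _)))

  detInvA₀-cancel : ∀ f → detInvA₀ * (det n I-A₀ * f) ≈ f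
  detInvA₀-cancel f = trans (sym (*-assoc _ _ _))
    (trans (*-congʳ (≐⇒~ (Inverse.invS-*S (det n I-A₀) det-I-A₀-constant))) (*-identityˡ f))

  -- The inverse cancels the factor det(I - A₀) of the bordered determinant, and the identity in I -
  -- C supplies the δ_ij missing from the block.
  I-C≈complement : ∀ i j → I-C i j ≈ Whole.complement i j
  I-C≈complement i j = begin
    idS i j - - (detInvA₀ * det (n +ℕ 1) (block i j))
      ≈⟨ +-cong (reflexive (≡.sym (idS-injective right (Finₚ.↑ʳ-injective n) i j))) (-‿involutive _) ⟩
    idS (right i) (right j) + detInvA₀ * det (n +ℕ 1) (block i j)
      ≈⟨ +-congˡ (trans (*-congˡ (Bordered.det-block i j)) (detInvA₀-cancel _)) ⟩
    idS (right i) (right j) + (- A (right i) (right j) - ∑ λ l → - A (right i) (left l) * X l j)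
      ≈⟨ sym (+-assoc _ _ _) ⟩
    I-A (right i) (right j) - ∑ (λ l → - A (right i) (left l) * X l j)
      -- The lower left entries of I - A contain a zero from the identity matrix, inserted here to
      -- match `complement`.
      ≈⟨ +-congˡ (-‿cong (∑-cong λ l → *-congʳ (sym (trans
           (+-congʳ (reflexive (idS-≢ {i = right i} {left l} (left≢right ∘ ≡.sym)))) (+-identityˡ _))))) ⟩
    Whole.complement i j ∎

  detInvA₀-det : detInvA₀ *S det (n +ℕ k) I-A ≈ det k I-C
  detInvA₀-det = begin
    detInvA₀ * det (n +ℕ k) I-A
      ≈⟨ *-congˡ (trans (det≈Det (n +ℕ k) I-A) Whole.Det-factor) ⟩
    detInvA₀ * (Det Whole.corner * Det Whole.complement)
      ≈⟨ *-congˡ (*-congʳ (trans (Det-cong λ i j → reflexive (I-A-left i j)) (sym (det≈Det n I-A₀)))) ⟩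
    detInvA₀ * (det n I-A₀ * Det Whole.complement)
      ≈⟨ detInvA₀-cancel _ ⟩
    Det Whole.complement
      ≈⟨ sym (trans (det≈Det k I-C) (Det-cong I-C≈complement)) ⟩
    det k I-C ∎

open import Data.Nat using (_+_)

theorem5p4 : ∀ {c ℓ} (K : CommutativeRing c ℓ) (n k : ℕ) → 1 ≤ n → 1 ≤ k →
    WithRing._≈CF_ K (WithRing._*S_ K (WithRing.Thm54.detInvA₀ K n k) (WithRing.det K (n + k) (WithRing.Thm54.I-A K n k)))
    (WithRing.det K k (WithRing.Thm54.I-C K n k))
theorem5p4 K n k _ _ = Theorem54.detInvA₀-det K n k
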